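{- Let $a$, $z$ and $q$ be complex numbers with $|z|<1$ and $|q|<1$. Then $$\sum_{n=0}^{\infty}\frac{(a;q)_n z^n}{(q;q)_n}=\frac{(az;q)_{\infty}}{(z;q)_{\infty}}.$$
   Context: Notation: $(x;q)_0=1$, $(x;q)_n=\prod_{j=0}^{n-1}(1-xq^{j})$ for $n\ge 1$, and $(x;q)_\infty=\prod_{j=0}^{\infty}(1-xq^{j})$, with the convention $x^0=1$ for all $x$. -}

module Defs where

open import Algebra.Bundles.Raw using (RawSemiring)
open import Data.Empty using (⊥-elim)
open import Data.Integer.Base as ℤ using (+_)
import Data.Integer.Properties as ℤ
open import Data.Nat.Base as ℕ using (ℕ; zero; suc)
import Data.Nat.Properties as ℕ
open import Data.Product using (∃-syntax; _×_; _,_; proj₁; proj₂)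
open import Data.Rational.Base as ℚ using (ℚ; 0ℚ; 1ℚ; ½)
import Data.Rational.Properties as ℚ
open import Data.Rational.Solver using (module +-*-Solver)
import Data.Rational.Unnormalised.Base as ℚᵘ
import Data.Rational.Unnormalised.Properties as ℚᵘ
open import Data.Sum.Base using (_⊎_; inj₁; inj₂)
open import Level using (0ℓ)
open import Relation.Binary.PropositionalEquality
  using (_≡_; refl; sym; trans; cong; cong₂; subst; subst₂)
open import Relation.Nullary using (yes; no)

------------------------------------------------------------------------
-- Rational arithmetic

dist : ℚ → ℚ → ℚ
dist p q = ℚ.∣ p ℚ.- q ∣

-- 1/p, extended by 0 at p = 0.
inv : ℚ → ℚ
inv p with p ℚ.≟ 0ℚ
... | yes _  = 0ℚ
... | no p≢0 = (ℚ.1/ p) {{ℚ.≢-nonZero p≢0}}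

infix 8 ½^_

nat : ℕ → ℚ
nat zero    = 0ℚ
nat (suc n) = 1ℚ ℚ.+ nat n

½^_ : ℕ → ℚ
½^ zero  = 1ℚ
½^ suc n = ½^ n ℚ.* ½

-- Bisection for √p on [0 , 1 + ∣p∣]; the left end stays at 0 when p < 0.
bisect : ℚ → ℕ → ℚ × ℚ
bisect p zero    = 0ℚ , 1ℚ ℚ.+ ℚ.∣ p ∣
bisect p (suc n) with bisect p n
... | l , h with ((l ℚ.+ h) ℚ.* ½) ℚ.* ((l ℚ.+ h) ℚ.* ½) ℚ.≤? p
...   | yes _ = (l ℚ.+ h) ℚ.* ½ , h
...   | no  _ = l , (l ℚ.+ h) ℚ.* ½

sqrtApprox : ℕ → ℚ → ℚ
sqrtApprox n p = proj₁ (bisect p n)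

------------------------------------------------------------------------
-- Cauchy sequences of rationals

Cauchy : (ℕ → ℚ) → Set
Cauchy f = ∀ ε → 0ℚ ℚ.< ε →
  ∃[ N ] ∀ m n → N ℕ.≤ m → N ℕ.≤ n → dist (f m) (f n) ℚ.< ε

open +-*-Solver using (solve; _:=_; _:+_; _:*_; :-_; _:-_; con)

opaque
  swap-* : ∀ x y i → x ℚ.* (y ℚ.* i) ≡ y ℚ.* (x ℚ.* i)
  swap-* = solve 3 (λ x y i → x :* (y :* i) := y :* (x :* i)) refl

  neg-diff : ∀ x y → ℚ.- (x ℚ.- y) ≡ y ℚ.- x
  neg-diff = solve 2 (λ x y → :- (x :- y) := y :- x) refl

  diff-neg : ∀ x y → y ℚ.- x ≡ ℚ.- x ℚ.- ℚ.- y
  diff-neg = solve 2 (λ x y → y :- x := :- x :- (:- y)) refl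

  diff+ : ∀ x y → x ≡ x ℚ.- y ℚ.+ y
  diff+ = solve 2 (λ x y → x := (x :- y) :+ y) refl

  diff-+ : ∀ a b c d → (a ℚ.+ b) ℚ.- (c ℚ.+ d) ≡ (a ℚ.- c) ℚ.+ (b ℚ.- d)
  diff-+ = solve 4 (λ a b c d → (a :+ b) :- (c :+ d) := (a :- c) :+ (b :- d)) refl

  diff-* : ∀ a b c d → a ℚ.* b ℚ.- c ℚ.* d ≡ a ℚ.* (b ℚ.- d) ℚ.+ d ℚ.* (a ℚ.- c)
  diff-* = solve 4 (λ a b c d → a :* b :- c :* d := a :* (b :- d) :+ d :* (a :- c)) refl

  diff-inv : ∀ p q u v → u ℚ.* (q ℚ.* v) ℚ.- v ℚ.* (p ℚ.* u) ≡ u ℚ.* v ℚ.* (q ℚ.- p)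
  diff-inv = solve 4 (λ p q u v → u :* (q :* v) :- v :* (p :* u) := u :* v :* (q :- p)) refl

  half+half : ∀ p → p ℚ.* ½ ℚ.+ p ℚ.* ½ ≡ p
  half+half p = trans (sym (ℚ.*-distribˡ-+ p ½ ½)) (ℚ.*-identityʳ p)

  *-pos : ∀ {p q} → 0ℚ ℚ.< p → 0ℚ ℚ.< q → 0ℚ ℚ.< p ℚ.* q
  *-pos {p} {q} 0<p 0<q = ℚ.positive⁻¹ (p ℚ.* q)
    {{ℚ.pos*pos⇒pos p {{ℚ.positive 0<p}} q {{ℚ.positive 0<q}}}}

  half-pos : ∀ {p} → 0ℚ ℚ.< p → 0ℚ ℚ.< p ℚ.* ½
  half-pos 0<p = *-pos 0<p (ℚ.positive⁻¹ ½)

  inv-* : ∀ {p} → 0ℚ ℚ.< p → p ℚ.* inv p ≡ 1ℚ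
  inv-* {p} 0<p with p ℚ.≟ 0ℚ
  ... | yes p≡0 = ⊥-elim (ℚ.<-irrefl (sym p≡0) 0<p)
  ... | no  p≢0 = ℚ.*-inverseʳ p {{ℚ.≢-nonZero p≢0}}

  inv-pos : ∀ {p} → 0ℚ ℚ.< p → 0ℚ ℚ.< inv p
  inv-pos {p} 0<p with p ℚ.≟ 0ℚ
  ... | yes p≡0 = ⊥-elim (ℚ.<-irrefl (sym p≡0) 0<p)
  ... | no  p≢0 = ℚ.positive⁻¹ _ {{ℚ.1/pos⇒pos p {{ℚ.positive 0<p}}}}

  ∣∣-*-< : ∀ {B δ} p q → 0ℚ ℚ.< B → ℚ.∣ p ∣ ℚ.≤ B → ℚ.∣ q ∣ ℚ.< δ →
           ℚ.∣ p ℚ.* q ∣ ℚ.< B ℚ.* δ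
  ∣∣-*-< {B} {δ} p q 0<B p≤B q<δ = begin-strict
    ℚ.∣ p ℚ.* q ∣          ≡⟨ ℚ.∣p*q∣≡∣p∣*∣q∣ p q ⟩
    ℚ.∣ p ∣ ℚ.* ℚ.∣ q ∣    ≤⟨ ℚ.*-monoʳ-≤-nonNeg ℚ.∣ q ∣ {{ℚ.∣-∣-nonNeg q}} p≤B ⟩
    B ℚ.* ℚ.∣ q ∣          <⟨ ℚ.*-monoʳ-<-pos B {{ℚ.positive 0<B}} q<δ ⟩
    B ℚ.* δ                ∎
    where open ℚ.≤-Reasoning

  *-cancel-inv : ∀ {p} q → 0ℚ ℚ.< p → p ℚ.* (q ℚ.* inv p) ≡ q
  *-cancel-inv {p} q 0<p = trans
    (swap-* p q (inv p))
    (trans (cong (q ℚ.*_) (inv-* 0<p)) (ℚ.*-identityʳ q))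

  ≤-+ʳ : ∀ p {q} → 0ℚ ℚ.≤ q → p ℚ.≤ p ℚ.+ q
  ≤-+ʳ p {q} 0≤q = subst (ℚ._≤ p ℚ.+ q) (ℚ.+-identityʳ p) (ℚ.+-monoʳ-≤ p 0≤q)

  ≤-+ˡ : ∀ p {q} → 0ℚ ℚ.≤ q → p ℚ.≤ q ℚ.+ p
  ≤-+ˡ p {q} 0≤q = subst (p ℚ.≤_) (ℚ.+-comm p q) (≤-+ʳ p 0≤q)

  ≤∣∣ : ∀ p → p ℚ.≤ ℚ.∣ p ∣
  ≤∣∣ p with ℚ.≤-total 0ℚ p
  ... | inj₁ 0≤p = ℚ.≤-reflexive (sym (ℚ.0≤p⇒∣p∣≡p 0≤p))
  ... | inj₂ p≤0 = ℚ.≤-trans p≤0 (ℚ.0≤∣p∣ p)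

  dist-sym : ∀ p q → dist p q ≡ dist q p
  dist-sym p q = trans (sym (ℚ.∣-p∣≡∣p∣ (p ℚ.- q)))
    (cong ℚ.∣_∣ (neg-diff p q))

  dist-< : ∀ {ε} p q → p ℚ.- q ℚ.< ε → q ℚ.- p ℚ.< ε → dist p q ℚ.< ε
  dist-< {ε} p q p-q<ε q-p<ε with ℚ.∣p∣≡p∨∣p∣≡-p (p ℚ.- q)
  ... | inj₁ e = subst (ℚ._< ε) (sym e) p-q<ε
  ... | inj₂ e = subst (ℚ._< ε)
    (sym (trans e (neg-diff p q))) q-p<ε

  sqr-mono-< : ∀ {p q} → 0ℚ ℚ.≤ p → p ℚ.< q → p ℚ.* p ℚ.< q ℚ.* q
  sqr-mono-< {p} {q} 0≤p p<q = ℚ.≤-<-trans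
    (ℚ.*-monoˡ-≤-nonNeg p {{ℚ.nonNegative 0≤p}} (ℚ.<⇒≤ p<q))
    (ℚ.*-monoˡ-<-pos q {{ℚ.positive (ℚ.≤-<-trans 0≤p p<q)}} p<q)

  nonNeg-* : ∀ {p q} → 0ℚ ℚ.≤ p → 0ℚ ℚ.≤ q → 0ℚ ℚ.≤ p ℚ.* q
  nonNeg-* {p} {q} 0≤p 0≤q = ℚ.nonNegative⁻¹ (p ℚ.* q)
    {{ℚ.nonNeg*nonNeg⇒nonNeg p {{ℚ.nonNegative 0≤p}} q {{ℚ.nonNegative 0≤q}}}}

  *-modulus : ∀ {B C ε} → 0ℚ ℚ.< B → 0ℚ ℚ.< C → 0ℚ ℚ.< ε →
    ∃[ δ ] 0ℚ ℚ.< δ × (∀ a b c d → ℚ.∣ a ∣ ℚ.≤ B → ℚ.∣ d ∣ ℚ.≤ C →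
      dist a c ℚ.< δ → dist b d ℚ.< δ → dist (a ℚ.* b) (c ℚ.* d) ℚ.< ε)
  *-modulus {B} {C} {ε} 0<B 0<C 0<ε =
    δ , *-pos 0<ε (inv-pos 0<B+C) , λ a b c d a≤B d≤C a-c b-d → begin-strict
    dist (a ℚ.* b) (c ℚ.* d)
      ≡⟨ cong ℚ.∣_∣ (diff-* a b c d) ⟩
    ℚ.∣ a ℚ.* (b ℚ.- d) ℚ.+ d ℚ.* (a ℚ.- c) ∣
      ≤⟨ ℚ.∣p+q∣≤∣p∣+∣q∣ (a ℚ.* (b ℚ.- d)) (d ℚ.* (a ℚ.- c)) ⟩
    ℚ.∣ a ℚ.* (b ℚ.- d) ∣ ℚ.+ ℚ.∣ d ℚ.* (a ℚ.- c) ∣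
      <⟨ ℚ.+-mono-< (∣∣-*-< a (b ℚ.- d) 0<B a≤B b-d) (∣∣-*-< d (a ℚ.- c) 0<C d≤C a-c) ⟩
    B ℚ.* δ ℚ.+ C ℚ.* δ
      ≡⟨ ℚ.*-distribʳ-+ δ B C ⟨
    (B ℚ.+ C) ℚ.* δ
      ≡⟨ *-cancel-inv ε 0<B+C ⟩
    ε ∎
    where
    open ℚ.≤-Reasoning
    0<B+C : 0ℚ ℚ.< B ℚ.+ C
    0<B+C = ℚ.+-mono-< 0<B 0<C
    δ : ℚ
    δ = ε ℚ.* inv (B ℚ.+ C)

  eventuallyBounded : ∀ {f} → Cauchy f →
    ∃[ B ] 0ℚ ℚ.< B × (∃[ N ] ∀ n → N ℕ.≤ n → ℚ.∣ f n ∣ ℚ.≤ B)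
  eventuallyBounded {f} f-cauchy with f-cauchy 1ℚ (ℚ.positive⁻¹ 1ℚ)
  ... | N , close = 1ℚ ℚ.+ ℚ.∣ f N ∣
                  , ℚ.<-≤-trans (ℚ.positive⁻¹ 1ℚ) (≤-+ʳ 1ℚ (ℚ.0≤∣p∣ (f N)))
                  , N , λ n N≤n → begin
    ℚ.∣ f n ∣
      ≡⟨ cong ℚ.∣_∣ (diff+ (f n) (f N)) ⟩
    ℚ.∣ f n ℚ.- f N ℚ.+ f N ∣      ≤⟨ ℚ.∣p+q∣≤∣p∣+∣q∣ (f n ℚ.- f N) (f N) ⟩
    dist (f n) (f N) ℚ.+ ℚ.∣ f N ∣
      ≤⟨ ℚ.+-monoˡ-≤ ℚ.∣ f N ∣ (ℚ.<⇒≤ (close n N N≤n ℕ.≤-refl)) ⟩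
    1ℚ ℚ.+ ℚ.∣ f N ∣               ∎
    where open ℚ.≤-Reasoning

  inv-modulus : ∀ {δ ε} → 0ℚ ℚ.< δ → 0ℚ ℚ.< ε →
    ∃[ η ] 0ℚ ℚ.< η ×
      (∀ p q → δ ℚ.≤ p → δ ℚ.≤ q → dist q p ℚ.< η → dist (inv p) (inv q) ℚ.< ε)
  inv-modulus {δ} {ε} 0<δ 0<ε =
    ε ℚ.* inv B , *-pos 0<ε (inv-pos 0<B) , λ p q δ≤p δ≤q q-p → begin-strict
    dist (inv p) (inv q)
      ≡⟨ cong ℚ.∣_∣ (diff p q (pos δ≤p) (pos δ≤q)) ⟩
    ℚ.∣ inv p ℚ.* inv q ℚ.* (q ℚ.- p) ∣
      <⟨ ∣∣-*-< (inv p ℚ.* inv q) (q ℚ.- p) 0<B (uv≤ δ≤p δ≤q) q-p ⟩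
    B ℚ.* (ε ℚ.* inv B)
      ≡⟨ *-cancel-inv ε 0<B ⟩
    ε ∎
    where
    open ℚ.≤-Reasoning

    B : ℚ
    B = inv δ ℚ.* inv δ

    0<B : 0ℚ ℚ.< B
    0<B = *-pos (inv-pos 0<δ) (inv-pos 0<δ)

    pos : ∀ {p} → δ ℚ.≤ p → 0ℚ ℚ.< p
    pos = ℚ.<-≤-trans 0<δ

    diff : ∀ p q → 0ℚ ℚ.< p → 0ℚ ℚ.< q →
           inv p ℚ.- inv q ≡ inv p ℚ.* inv q ℚ.* (q ℚ.- p)
    diff p q 0<p 0<q = begin-equality
      inv p ℚ.- inv q
        ≡⟨ cong₂ ℚ._-_ (ℚ.*-identityʳ (inv p)) (ℚ.*-identityʳ (inv q)) ⟨
      inv p ℚ.* 1ℚ ℚ.- inv q ℚ.* 1ℚ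
        ≡⟨ cong₂ (λ x y → inv p ℚ.* x ℚ.- inv q ℚ.* y) (inv-* 0<q) (inv-* 0<p) ⟨
      inv p ℚ.* (q ℚ.* inv q) ℚ.- inv q ℚ.* (p ℚ.* inv p)
        ≡⟨ diff-inv p q (inv p) (inv q) ⟩
      inv p ℚ.* inv q ℚ.* (q ℚ.- p) ∎

    inv-≤ : ∀ {p} → δ ℚ.≤ p → inv p ℚ.≤ inv δ
    inv-≤ {p} δ≤p = begin
      inv p                        ≡⟨ *-cancel-inv (inv p) 0<δ ⟨
      δ ℚ.* (inv p ℚ.* inv δ)
        ≤⟨ ℚ.*-monoʳ-≤-nonNeg (inv p ℚ.* inv δ)
             {{ℚ.nonNegative (ℚ.<⇒≤ (*-pos (inv-pos (pos δ≤p)) (inv-pos 0<δ)))}} δ≤p ⟩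
      p ℚ.* (inv p ℚ.* inv δ)      ≡⟨ cong (p ℚ.*_) (ℚ.*-comm (inv p) (inv δ)) ⟩
      p ℚ.* (inv δ ℚ.* inv p)      ≡⟨ *-cancel-inv (inv δ) (pos δ≤p) ⟩
      inv δ                        ∎

    uv≤ : ∀ {p q} → δ ℚ.≤ p → δ ℚ.≤ q → ℚ.∣ inv p ℚ.* inv q ∣ ℚ.≤ inv δ ℚ.* inv δ
    uv≤ {p} {q} δ≤p δ≤q = begin
      ℚ.∣ inv p ℚ.* inv q ∣
        ≡⟨ ℚ.0≤p⇒∣p∣≡p (ℚ.<⇒≤ (*-pos (inv-pos (pos δ≤p)) (inv-pos (pos δ≤q)))) ⟩
      inv p ℚ.* inv q
        ≤⟨ ℚ.*-monoʳ-≤-nonNeg (inv q) {{ℚ.nonNegative (ℚ.<⇒≤ (inv-pos (pos δ≤q)))}} (inv-≤ δ≤p) ⟩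
      inv δ ℚ.* inv q
        ≤⟨ ℚ.*-monoˡ-≤-nonNeg (inv δ) {{ℚ.nonNegative (ℚ.<⇒≤ (inv-pos 0<δ))}} (inv-≤ δ≤q) ⟩
      inv δ ℚ.* inv δ ∎

  nat-toℚᵘ : ∀ n → ℚ.toℚᵘ (nat n) ℚᵘ.≃ ℚᵘ.mkℚᵘ (+ n) 0
  nat-toℚᵘ zero    = ℚᵘ.≃-refl
  nat-toℚᵘ (suc n) = ℚᵘ.≃-trans (ℚ.toℚᵘ-homo-+ 1ℚ (nat n))
    (ℚᵘ.≃-trans (ℚᵘ.+-congʳ (ℚ.toℚᵘ 1ℚ) (nat-toℚᵘ n))
      (ℚᵘ.*≡* (cong (λ i → (+ 1 ℤ.+ i) ℤ.* + 1) (ℤ.*-identityʳ (+ n)))))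

  archimedean : ∀ p → ∃[ n ] p ℚ.≤ nat n
  archimedean p = ℤ.∣ ℚ.↥ p ∣ , ℚ.≤-trans (≤∣∣ p) (bound p)
    where
    bound : ∀ p → ℚ.∣ p ∣ ℚ.≤ nat ℤ.∣ ℚ.↥ p ∣
    bound p@(ℚ.mkℚ a d _) = ℚ.toℚᵘ-cancel-≤
      (ℚᵘ.≤-respʳ-≃ (ℚᵘ.≃-sym (nat-toℚᵘ ℤ.∣ a ∣))
        (ℚᵘ.*≤* (subst₂ ℤ._≤_ (ℤ.pos-* ℤ.∣ a ∣ 1) (ℤ.pos-* ℤ.∣ a ∣ (suc d))
          (ℤ.+≤+ (ℕ.*-monoʳ-≤ ℤ.∣ a ∣ (ℕ.s≤s (ℕ.z≤n {d})))))))

  ½^-pos : ∀ n → 0ℚ ℚ.< ½^ n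
  ½^-pos zero    = ℚ.positive⁻¹ 1ℚ
  ½^-pos (suc n) = half-pos (½^-pos n)

  ½^-anti : ∀ {m n} → m ℕ.≤ n → ½^ n ℚ.≤ ½^ m
  ½^-anti m≤n = go (ℕ.≤⇒≤′ m≤n)
    where
    go : ∀ {m n} → m ℕ.≤′ n → ½^ n ℚ.≤ ½^ m
    go ℕ.≤′-refl = ℚ.≤-refl
    go {m} {suc n} (ℕ.≤′-step m≤′n) = ℚ.≤-trans
      (subst ((½^ n) ℚ.* ½ ℚ.≤_) (half+half (½^ n)) (≤-+ʳ ((½^ n) ℚ.* ½) (ℚ.<⇒≤ (half-pos (½^-pos n)))))
      (go m≤′n)

  nat-½^ : ∀ n → nat n ℚ.* ½^ n ℚ.≤ 1ℚ
  nat-½^ zero    = ℚ.≤-trans (ℚ.≤-reflexive (ℚ.*-zeroˡ 1ℚ)) (ℚ.<⇒≤ (ℚ.positive⁻¹ 1ℚ))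
  nat-½^ (suc n) = begin
    (1ℚ ℚ.+ nat n) ℚ.* (½^ n ℚ.* ½)
      ≡⟨ split (nat n) (½^ n) ½ ⟩
    ½^ n ℚ.* ½ ℚ.+ nat n ℚ.* ½^ n ℚ.* ½
      ≤⟨ ℚ.+-mono-≤ (ℚ.*-monoʳ-≤-nonNeg ½ (½^-anti (ℕ.z≤n {n}))) (ℚ.*-monoʳ-≤-nonNeg ½ (nat-½^ n)) ⟩
    1ℚ ℚ.* ½ ℚ.+ 1ℚ ℚ.* ½
      ≡⟨ half+half 1ℚ ⟩
    1ℚ ∎
    where
    open ℚ.≤-Reasoning
    split : ∀ a x h → (1ℚ ℚ.+ a) ℚ.* (x ℚ.* h) ≡ x ℚ.* h ℚ.+ a ℚ.* x ℚ.* h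
    split = solve 3 (λ a x h → (con 1ℚ :+ a) :* (x :* h) := x :* h :+ a :* x :* h) refl

  half-< : ∀ {p} → 0ℚ ℚ.< p → p ℚ.* ½ ℚ.< p
  half-< {p} 0<p = subst₂ ℚ._<_ (ℚ.+-identityʳ (p ℚ.* ½)) (half+half p)
    (ℚ.+-monoʳ-< (p ℚ.* ½) (half-pos 0<p))

  ½^-small : ∀ {K ε} → 0ℚ ℚ.< K → 0ℚ ℚ.< ε → ∃[ N ] ∀ n → N ℕ.≤ n → K ℚ.* ½^ n ℚ.< ε
  ½^-small {K} {ε} 0<K 0<ε with archimedean (K ℚ.* inv ε)
  ... | M , K/ε≤M = suc M , λ n M<n → begin-strict
    K ℚ.* ½^ n
      ≤⟨ ℚ.*-monoˡ-≤-nonNeg K {{ℚ.nonNegative (ℚ.<⇒≤ 0<K)}} (½^-anti M<n) ⟩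
    K ℚ.* (½^ M ℚ.* ½)
      ≡⟨ ℚ.*-assoc K (½^ M) ½ ⟨
    K ℚ.* ½^ M ℚ.* ½
      ≤⟨ ℚ.*-monoʳ-≤-nonNeg ½ K½^M≤ε ⟩
    ε ℚ.* ½
      <⟨ half-< 0<ε ⟩
    ε ∎
    where
    open ℚ.≤-Reasoning
    K½^M≤ε : K ℚ.* ½^ M ℚ.≤ ε
    K½^M≤ε = begin
      K ℚ.* ½^ M
        ≡⟨ cong (ℚ._* ½^ M) (*-cancel-inv K 0<ε) ⟨
      ε ℚ.* (K ℚ.* inv ε) ℚ.* ½^ M
        ≤⟨ ℚ.*-monoʳ-≤-nonNeg (½^ M) {{ℚ.nonNegative (ℚ.<⇒≤ (½^-pos M))}}
             (ℚ.*-monoˡ-≤-nonNeg ε {{ℚ.nonNegative (ℚ.<⇒≤ 0<ε)}} K/ε≤M) ⟩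
      ε ℚ.* nat M ℚ.* ½^ M
        ≡⟨ ℚ.*-assoc ε (nat M) (½^ M) ⟩
      ε ℚ.* (nat M ℚ.* ½^ M)
        ≤⟨ ℚ.*-monoˡ-≤-nonNeg ε {{ℚ.nonNegative (ℚ.<⇒≤ 0<ε)}} (nat-½^ M) ⟩
      ε ℚ.* 1ℚ
        ≡⟨ ℚ.*-identityʳ ε ⟩
      ε ∎

  midpoint-≥ : ∀ {l h} → l ℚ.≤ h → l ℚ.≤ (l ℚ.+ h) ℚ.* ½
  midpoint-≥ {l} {h} l≤h = subst (ℚ._≤ (l ℚ.+ h) ℚ.* ½)
    (trans (ℚ.*-distribʳ-+ ½ l l) (half+half l))
    (ℚ.*-monoʳ-≤-nonNeg ½ (ℚ.+-monoʳ-≤ l l≤h))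

  midpoint-≤ : ∀ {l h} → l ℚ.≤ h → (l ℚ.+ h) ℚ.* ½ ℚ.≤ h
  midpoint-≤ {l} {h} l≤h = subst ((l ℚ.+ h) ℚ.* ½ ℚ.≤_)
    (trans (ℚ.*-distribʳ-+ ½ h h) (half+half h))
    (ℚ.*-monoʳ-≤-nonNeg ½ (ℚ.+-monoˡ-≤ h l≤h))

record Bracket (p : ℚ) (n : ℕ) (l h : ℚ) : Set where
  field
    0≤l   : 0ℚ ℚ.≤ l
    l≤h   : l ℚ.≤ h
    lower : l ≡ 0ℚ ⊎ l ℚ.* l ℚ.≤ p
    upper : p ℚ.≤ h ℚ.* h
    width : h ℚ.- l ≡ (1ℚ ℚ.+ ℚ.∣ p ∣) ℚ.* ½^ n

opaque
  left-half : ∀ l h → (l ℚ.+ h) ℚ.* ½ ℚ.- l ≡ (h ℚ.- l) ℚ.* ½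
  left-half = solve 2 (λ l h → (l :+ h) :* con ½ :- l := (h :- l) :* con ½) refl

  right-half : ∀ l h → h ℚ.- (l ℚ.+ h) ℚ.* ½ ≡ (h ℚ.- l) ℚ.* ½
  right-half = solve 2 (λ l h → h :- (l :+ h) :* con ½ := (h :- l) :* con ½) refl

  square-+ : ∀ x y → (x ℚ.+ y) ℚ.* (x ℚ.+ y) ≡ x ℚ.* x ℚ.+ y ℚ.* y ℚ.+ (x ℚ.* y ℚ.+ x ℚ.* y)
  square-+ = solve 2 (λ x y → (x :+ y) :* (x :+ y) := x :* x :+ y :* y :+ (x :* y :+ x :* y)) refl

  diff-+ˡ : ∀ x y z → x ℚ.+ y ℚ.- z ≡ x ℚ.- z ℚ.+ y
  diff-+ˡ = solve 3 (λ x y z → x :+ y :- z := x :- z :+ y) refl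

  halve : ∀ {w d K n} → w ≡ d ℚ.* ½ → d ≡ K ℚ.* ½^ n → w ≡ K ℚ.* (½^ n ℚ.* ½)
  halve {K = K} {n} w≡d½ d≡K½^n =
    trans w≡d½ (trans (cong (ℚ._* ½) d≡K½^n) (ℚ.*-assoc K (½^ n) ½))

  bisect-bracket : ∀ p n → Bracket p n (proj₁ (bisect p n)) (proj₂ (bisect p n))
  bisect-bracket p zero = record
    { 0≤l   = ℚ.≤-refl
    ; l≤h   = 0≤1+∣p∣
    ; lower = inj₁ refl
    ; upper = begin
        p                               ≤⟨ ≤∣∣ p ⟩
        a                               ≤⟨ ≤-+ʳ a (nonNeg-* (ℚ.0≤∣p∣ p) (ℚ.0≤∣p∣ p)) ⟩
        a ℚ.+ a ℚ.* a                   ≤⟨ ≤-+ˡ (a ℚ.+ a ℚ.* a) 0≤1+∣p∣ ⟩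
        (1ℚ ℚ.+ a) ℚ.+ (a ℚ.+ a ℚ.* a)  ≡⟨ square a ⟨
        (1ℚ ℚ.+ a) ℚ.* (1ℚ ℚ.+ a)       ∎
    ; width = trans (ℚ.+-identityʳ (1ℚ ℚ.+ a)) (sym (ℚ.*-identityʳ (1ℚ ℚ.+ a)))
    }
    where
    open ℚ.≤-Reasoning
    a : ℚ
    a = ℚ.∣ p ∣
    0≤1+∣p∣ : 0ℚ ℚ.≤ 1ℚ ℚ.+ a
    0≤1+∣p∣ = ℚ.≤-trans (ℚ.0≤∣p∣ p) (≤-+ˡ a (ℚ.<⇒≤ (ℚ.positive⁻¹ 1ℚ)))
    square : ∀ x → (1ℚ ℚ.+ x) ℚ.* (1ℚ ℚ.+ x) ≡ (1ℚ ℚ.+ x) ℚ.+ (x ℚ.+ x ℚ.* x)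
    square = solve 1 (λ x → (con 1ℚ :+ x) :* (con 1ℚ :+ x) := (con 1ℚ :+ x) :+ (x :+ x :* x)) refl
  bisect-bracket p (suc n) with bisect p n | bisect-bracket p n
  ... | l , h | b with ((l ℚ.+ h) ℚ.* ½) ℚ.* ((l ℚ.+ h) ℚ.* ½) ℚ.≤? p
  ...   | yes m²≤p = record
    { 0≤l   = ℚ.≤-trans 0≤l (midpoint-≥ l≤h)
    ; l≤h   = midpoint-≤ l≤h
    ; lower = inj₂ m²≤p
    ; upper = upper
    ; width = halve {K = 1ℚ ℚ.+ ℚ.∣ p ∣} {n} (right-half l h) width
    }
    where open Bracket b
  ...   | no  m²≰p = record
    { 0≤l   = 0≤l
    ; l≤h   = midpoint-≥ l≤h
    ; lower = lower
    ; upper = ℚ.<⇒≤ (ℚ.≰⇒> m²≰p)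
    ; width = halve {K = 1ℚ ℚ.+ ℚ.∣ p ∣} {n} (left-half l h) width
    }
    where open Bracket b

  ≤-bisect : ∀ {p q δ} m n → 0ℚ ℚ.< δ → p ℚ.≤ q ℚ.+ δ ℚ.* δ →
             proj₁ (bisect p m) ℚ.≤ proj₂ (bisect q n) ℚ.+ δ
  ≤-bisect {p} {q} {δ} m n 0<δ p≤q+δ² =
    go (bisect-bracket p m) (bisect-bracket q n)
    where
    go : ∀ {l h l′ h′} → Bracket p m l h → Bracket q n l′ h′ → l ℚ.≤ h′ ℚ.+ δ
    go {l} {_} {l′} {h′} b b′ with l ℚ.≤? h′ ℚ.+ δ
    ... | yes l≤h′+δ = l≤h′+δ
    ... | no  l≰h′+δ = ⊥-elim (ℚ.<-irrefl refl (absurd (Bracket.lower b)))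
      where
      open ℚ.≤-Reasoning
      0≤h′ : 0ℚ ℚ.≤ h′
      0≤h′ = ℚ.≤-trans (Bracket.0≤l b′) (Bracket.l≤h b′)
      0≤h′+δ : 0ℚ ℚ.≤ h′ ℚ.+ δ
      0≤h′+δ = ℚ.≤-trans 0≤h′ (≤-+ʳ h′ (ℚ.<⇒≤ 0<δ))
      h′+δ<l : h′ ℚ.+ δ ℚ.< l
      h′+δ<l = ℚ.≰⇒> l≰h′+δ
      absurd : l ≡ 0ℚ ⊎ l ℚ.* l ℚ.≤ p → l ℚ.* l ℚ.< l ℚ.* l
      absurd (inj₁ l≡0) = ⊥-elim (ℚ.<-irrefl (sym l≡0) (ℚ.≤-<-trans 0≤h′+δ h′+δ<l))
      absurd (inj₂ l²≤p) = begin-strict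
        l ℚ.* l                                   ≤⟨ l²≤p ⟩
        p                                         ≤⟨ p≤q+δ² ⟩
        q ℚ.+ δ ℚ.* δ                             ≤⟨ ℚ.+-monoˡ-≤ (δ ℚ.* δ) (Bracket.upper b′) ⟩
        h′ ℚ.* h′ ℚ.+ δ ℚ.* δ                     ≤⟨ ≤-+ʳ (h′ ℚ.* h′ ℚ.+ δ ℚ.* δ) 0≤cross ⟩
        h′ ℚ.* h′ ℚ.+ δ ℚ.* δ ℚ.+ (h′ ℚ.* δ ℚ.+ h′ ℚ.* δ) ≡⟨ square-+ h′ δ ⟨
        (h′ ℚ.+ δ) ℚ.* (h′ ℚ.+ δ)                 <⟨ sqr-mono-< 0≤h′+δ h′+δ<l ⟩
        l ℚ.* l                                   ∎
        where
        0≤cross : 0ℚ ℚ.≤ h′ ℚ.* δ ℚ.+ h′ ℚ.* δ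
        0≤cross = ℚ.+-mono-≤ (nonNeg-* 0≤h′ (ℚ.<⇒≤ 0<δ)) (nonNeg-* 0≤h′ (ℚ.<⇒≤ 0<δ))

  sqrt-modulus : ∀ {B ε} → 0ℚ ℚ.< B → 0ℚ ℚ.< ε →
    ∃[ N ] ∃[ η ] 0ℚ ℚ.< η ×
      (∀ m n p q → N ℕ.≤ m → N ℕ.≤ n → ℚ.∣ p ∣ ℚ.≤ B → ℚ.∣ q ∣ ℚ.≤ B →
        dist p q ℚ.< η → dist (sqrtApprox m p) (sqrtApprox n q) ℚ.< ε)
  sqrt-modulus {B} {ε} 0<B 0<ε =
    N , δ ℚ.* δ , *-pos 0<δ 0<δ , λ m n p q N≤m N≤n p≤B q≤B p-q<δ² →
      dist-< (sqrtApprox m p) (sqrtApprox n q)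
        (one-sided m n p q N≤n q≤B p-q<δ²)
        (one-sided n m q p N≤m p≤B (subst (ℚ._< δ ℚ.* δ) (dist-sym p q) p-q<δ²))
    where
    open ℚ.≤-Reasoning
    δ : ℚ
    δ = ε ℚ.* ½
    0<δ : 0ℚ ℚ.< δ
    0<δ = half-pos 0<ε
    small : ∃[ N ] ∀ n → N ℕ.≤ n → (1ℚ ℚ.+ B) ℚ.* ½^ n ℚ.< δ
    small = ½^-small (ℚ.+-mono-< (ℚ.positive⁻¹ 1ℚ) 0<B) 0<δ
    N : ℕ
    N = proj₁ small

    one-sided : ∀ m n p q → N ℕ.≤ n → ℚ.∣ q ∣ ℚ.≤ B → dist p q ℚ.< δ ℚ.* δ →
                sqrtApprox m p ℚ.- sqrtApprox n q ℚ.< ε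
    one-sided m n p q N≤n q≤B p-q<δ² = begin-strict
      sqrtApprox m p ℚ.- l
        ≤⟨ ℚ.+-monoˡ-≤ (ℚ.- l) (≤-bisect m n 0<δ p≤q+δ²) ⟩
      h ℚ.+ δ ℚ.- l
        ≡⟨ diff-+ˡ h δ l ⟩
      h ℚ.- l ℚ.+ δ
        ≡⟨ cong (ℚ._+ δ) (Bracket.width (bisect-bracket q n)) ⟩
      (1ℚ ℚ.+ ℚ.∣ q ∣) ℚ.* ½^ n ℚ.+ δ
        ≤⟨ ℚ.+-monoˡ-≤ δ (ℚ.*-monoʳ-≤-nonNeg (½^ n) {{ℚ.nonNegative (ℚ.<⇒≤ (½^-pos n))}}
             (ℚ.+-monoʳ-≤ 1ℚ q≤B)) ⟩
      (1ℚ ℚ.+ B) ℚ.* ½^ n ℚ.+ δ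
        <⟨ ℚ.+-monoˡ-< δ (proj₂ small n N≤n) ⟩
      δ ℚ.+ δ
        ≡⟨ half+half ε ⟩
      ε ∎
      where
      l h : ℚ
      l = proj₁ (bisect q n)
      h = proj₂ (bisect q n)
      p≤q+δ² : p ℚ.≤ q ℚ.+ δ ℚ.* δ
      p≤q+δ² = begin
        p                     ≡⟨ diff+ p q ⟩
        p ℚ.- q ℚ.+ q         ≤⟨ ℚ.+-monoˡ-≤ q (ℚ.≤-trans (≤∣∣ (p ℚ.- q)) (ℚ.<⇒≤ p-q<δ²)) ⟩
        δ ℚ.* δ ℚ.+ q         ≡⟨ ℚ.+-comm (δ ℚ.* δ) q ⟩
        q ℚ.+ δ ℚ.* δ         ∎

opaque
  const-cauchy : ∀ p → Cauchy (λ _ → p)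
  const-cauchy p ε 0<ε =
    0 , λ _ _ _ _ → subst (ℚ._< ε) (cong ℚ.∣_∣ (sym (ℚ.+-inverseʳ p))) 0<ε

  +-cauchy : ∀ {f g} → Cauchy f → Cauchy g → Cauchy (λ n → f n ℚ.+ g n)
  +-cauchy {f} {g} f-cauchy g-cauchy ε 0<ε
    with f-cauchy (ε ℚ.* ½) (half-pos 0<ε) | g-cauchy (ε ℚ.* ½) (half-pos 0<ε)
  ... | M , f-close | N , g-close = M ℕ.⊔ N , λ m n M⊔N≤m M⊔N≤n → begin-strict
    dist (f m ℚ.+ g m) (f n ℚ.+ g n)
      ≡⟨ cong ℚ.∣_∣ (diff-+ (f m) (g m) (f n) (g n)) ⟩
    ℚ.∣ (f m ℚ.- f n) ℚ.+ (g m ℚ.- g n) ∣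
      ≤⟨ ℚ.∣p+q∣≤∣p∣+∣q∣ (f m ℚ.- f n) (g m ℚ.- g n) ⟩
    dist (f m) (f n) ℚ.+ dist (g m) (g n)
      <⟨ ℚ.+-mono-< (f-close m n (ℕ.m⊔n≤o⇒m≤o M N M⊔N≤m) (ℕ.m⊔n≤o⇒m≤o M N M⊔N≤n))
                    (g-close m n (ℕ.m⊔n≤o⇒n≤o M N M⊔N≤m) (ℕ.m⊔n≤o⇒n≤o M N M⊔N≤n)) ⟩
    ε ℚ.* ½ ℚ.+ ε ℚ.* ½
      ≡⟨ half+half ε ⟩
    ε ∎
    where open ℚ.≤-Reasoning

  neg-cauchy : ∀ {f} → Cauchy f → Cauchy (λ n → ℚ.- f n)
  neg-cauchy {f} f-cauchy ε 0<ε with f-cauchy ε 0<ε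
  ... | N , close = N , λ m n N≤m N≤n → subst (ℚ._< ε)
    (trans (dist-sym (f m) (f n))
      (cong ℚ.∣_∣ (diff-neg (f m) (f n))))
    (close m n N≤m N≤n)

  *-cauchy : ∀ {f g} → Cauchy f → Cauchy g → Cauchy (λ n → f n ℚ.* g n)
  *-cauchy {f} {g} f-cauchy g-cauchy ε 0<ε
    with eventuallyBounded f-cauchy | eventuallyBounded g-cauchy
  ... | B , 0<B , K , f≤B | C , 0<C , L , g≤C
    with *-modulus 0<B 0<C 0<ε
  ... | δ , 0<δ , close
    with f-cauchy δ 0<δ | g-cauchy δ 0<δ
  ... | M , f-close | N , g-close = (K ℕ.⊔ L) ℕ.⊔ (M ℕ.⊔ N) , λ m n m≥ n≥ →
    let K⊔L≤m = ℕ.m⊔n≤o⇒m≤o (K ℕ.⊔ L) (M ℕ.⊔ N) m≥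
        K⊔L≤n = ℕ.m⊔n≤o⇒m≤o (K ℕ.⊔ L) (M ℕ.⊔ N) n≥
        M⊔N≤m = ℕ.m⊔n≤o⇒n≤o (K ℕ.⊔ L) (M ℕ.⊔ N) m≥
        M⊔N≤n = ℕ.m⊔n≤o⇒n≤o (K ℕ.⊔ L) (M ℕ.⊔ N) n≥
    in close (f m) (g m) (f n) (g n)
         (f≤B m (ℕ.m⊔n≤o⇒m≤o K L K⊔L≤m))
         (g≤C n (ℕ.m⊔n≤o⇒n≤o K L K⊔L≤n))
         (f-close m n (ℕ.m⊔n≤o⇒m≤o M N M⊔N≤m) (ℕ.m⊔n≤o⇒m≤o M N M⊔N≤n))
         (g-close m n (ℕ.m⊔n≤o⇒n≤o M N M⊔N≤m) (ℕ.m⊔n≤o⇒n≤o M N M⊔N≤n))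

  inv-cauchy : ∀ {f δ N} → 0ℚ ℚ.< δ → (∀ n → N ℕ.≤ n → δ ℚ.≤ f n) →
               Cauchy f → Cauchy (λ n → inv (f n))
  inv-cauchy {f} {δ} {N} 0<δ δ≤f f-cauchy ε 0<ε with inv-modulus 0<δ 0<ε
  ... | η , 0<η , inv-close with f-cauchy η 0<η
  ... | M , f-close = N ℕ.⊔ M , λ m n m≥ n≥ → inv-close (f m) (f n)
    (δ≤f m (ℕ.m⊔n≤o⇒m≤o N M m≥)) (δ≤f n (ℕ.m⊔n≤o⇒m≤o N M n≥))
    (f-close n m (ℕ.m⊔n≤o⇒n≤o N M n≥) (ℕ.m⊔n≤o⇒n≤o N M m≥))

  sqrt-cauchy : ∀ {f} → Cauchy f → Cauchy (λ n → sqrtApprox n (f n))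
  sqrt-cauchy {f} f-cauchy ε 0<ε with eventuallyBounded f-cauchy
  ... | B , 0<B , K , f≤B with sqrt-modulus 0<B 0<ε
  ... | N , η , 0<η , sqrt-close with f-cauchy η 0<η
  ... | M , f-close = K ℕ.⊔ (N ℕ.⊔ M) , λ m n m≥ n≥ →
    let N⊔M≤m = ℕ.m⊔n≤o⇒n≤o K (N ℕ.⊔ M) m≥
        N⊔M≤n = ℕ.m⊔n≤o⇒n≤o K (N ℕ.⊔ M) n≥
    in sqrt-close m n (f m) (f n)
         (ℕ.m⊔n≤o⇒m≤o N M N⊔M≤m) (ℕ.m⊔n≤o⇒m≤o N M N⊔M≤n)
         (f≤B m (ℕ.m⊔n≤o⇒m≤o K (N ℕ.⊔ M) m≥)) (f≤B n (ℕ.m⊔n≤o⇒m≤o K (N ℕ.⊔ M) n≥))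
         (f-close m n (ℕ.m⊔n≤o⇒n≤o N M N⊔M≤m) (ℕ.m⊔n≤o⇒n≤o N M N⊔M≤n))

------------------------------------------------------------------------
-- Real numbers

record ℝ : Set where
  constructor mkℝ
  field
    seq    : ℕ → ℚ
    cauchy : Cauchy seq

open ℝ public

infix  4 _≈ᴿ_ _<ᴿ_
infixl 6 _+ᴿ_
infixl 7 _*ᴿ_
infix  8 -ᴿ_

_≈ᴿ_ : ℝ → ℝ → Set
x ≈ᴿ y = ∀ ε → 0ℚ ℚ.< ε → ∃[ N ] ∀ n → N ℕ.≤ n → dist (seq x n) (seq y n) ℚ.< ε

_<ᴿ_ : ℝ → ℝ → Set
x <ᴿ y = ∃[ ε ] 0ℚ ℚ.< ε × ∃[ N ] ∀ n → N ℕ.≤ n → seq x n ℚ.+ ε ℚ.≤ seq y n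

0ᴿ 1ᴿ : ℝ
0ᴿ = mkℝ (λ _ → 0ℚ) (const-cauchy 0ℚ)
1ᴿ = mkℝ (λ _ → 1ℚ) (const-cauchy 1ℚ)

_+ᴿ_ _*ᴿ_ : ℝ → ℝ → ℝ
x +ᴿ y = mkℝ (λ n → seq x n ℚ.+ seq y n) (+-cauchy {seq x} {seq y} (cauchy x) (cauchy y))
x *ᴿ y = mkℝ (λ n → seq x n ℚ.* seq y n) (*-cauchy {seq x} {seq y} (cauchy x) (cauchy y))

-ᴿ_ : ℝ → ℝ
-ᴿ x = mkℝ (λ n → ℚ.- seq x n) (neg-cauchy {seq x} (cauchy x))

recip : (x : ℝ) → 0ᴿ <ᴿ x → ℝ
recip x (ε , 0<ε , N , ε≤x) = mkℝ (λ n → inv (seq x n))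
  (inv-cauchy {seq x} 0<ε
    (λ n N≤n → subst (ℚ._≤ seq x n) (ℚ.+-identityˡ ε) (ε≤x n N≤n))
    (cauchy x))

-- √x for x ≥ 0, and 0 for x ≤ 0: the n-th term carries out n bisection steps.
√ : ℝ → ℝ
√ x = mkℝ (λ n → sqrtApprox n (seq x n)) (sqrt-cauchy {seq x} (cauchy x))

------------------------------------------------------------------------
-- Complex numbers

record ℂ : Set where
  constructor mkℂ
  field
    re im : ℝ

open ℂ public

infix  4 _≈_
infixl 6 _+_ _-_
infixl 7 _*_ _/_⟨_⟩
infix  8 -_

_≈_ : ℂ → ℂ → Set
z ≈ w = re z ≈ᴿ re w × im z ≈ᴿ im w

0ℂ 1ℂ : ℂ
0ℂ = mkℂ 0ᴿ 0ᴿ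
1ℂ = mkℂ 1ᴿ 0ᴿ

-_ : ℂ → ℂ
- z = mkℂ (-ᴿ re z) (-ᴿ im z)

_+_ _*_ _-_ : ℂ → ℂ → ℂ
z + w = mkℂ (re z +ᴿ re w) (im z +ᴿ im w)
z * w = mkℂ (re z *ᴿ re w +ᴿ -ᴿ (im z *ᴿ im w)) (re z *ᴿ im w +ᴿ im z *ᴿ re w)
z - w = z + - w

∣_∣² : ℂ → ℝ
∣ z ∣² = re z *ᴿ re z +ᴿ im z *ᴿ im z

∣_∣ : ℂ → ℝ
∣ z ∣ = √ ∣ z ∣²

-- Constructive nonvanishing: z is bounded away from 0.
infix 4 _#0
_#0 : ℂ → Set
z #0 = 0ᴿ <ᴿ ∣ z ∣²

_/_⟨_⟩ : ℂ → (w : ℂ) → w #0 → ℂ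
z / w ⟨ w#0 ⟩ = z * mkℂ (re w *ᴿ r) (-ᴿ im w *ᴿ r)
  where
  r : ℝ
  r = recip ∣ w ∣² w#0

ℂ-rawSemiring : RawSemiring 0ℓ 0ℓ
ℂ-rawSemiring = record
  { Carrier = ℂ ; _≈_ = _≈_ ; _+_ = _+_ ; _*_ = _*_ ; 0# = 0ℂ ; 1# = 1ℂ }

-- z ^ 0 is 1ℂ for every z, including 0ℂ.
open import Algebra.Definitions.RawSemiring ℂ-rawSemiring public using (_^_)

------------------------------------------------------------------------
-- Limits, series and q-shifted factorials

infix 4 _⟶_
_⟶_ : (ℕ → ℂ) → ℂ → Set
f ⟶ l = ∀ ε → 0ᴿ <ᴿ ε → ∃[ N ] ∀ n → N ℕ.≤ n → ∣ f n - l ∣ <ᴿ ε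

∑< ∏< : ℕ → (ℕ → ℂ) → ℂ
∑< zero    f = 0ℂ
∑< (suc n) f = ∑< n f + f n
∏< zero    f = 1ℂ
∏< (suc n) f = ∏< n f * f n

HasSum HasProduct : (ℕ → ℂ) → ℂ → Set
HasSum     f s = (λ n → ∑< n f) ⟶ s
HasProduct f p = (λ n → ∏< n f) ⟶ p

pochFactor : ℂ → ℂ → ℕ → ℂ
pochFactor x q j = 1ℂ - x * q ^ j

-- (x;q)ₙ
poch : ℂ → ℂ → ℕ → ℂ
poch x q n = ∏< n (pochFactor x q)

-- (x;q)_∞ exists and equals p.
IsPoch∞ : ℂ → ℂ → ℂ → Set
IsPoch∞ x q p = HasProduct (pochFactor x q) p

-- Write A n = (a;q)ₙ / (q;q)ₙ and F(y) = ∑ A n zⁿ yⁿ.  Comparing coefficients gives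
-- (1 − zy) F(y) = (1 − azy) F(qy), hence (z;q)ₖ F(1) = (az;q)ₖ F(qᵏ), and F(qᵏ) → 1
-- as k → ∞.  For partial sums the functional equation holds up to a boundary term
-- that vanishes in the limit.  Series and products converge by the ratio test, the
-- partial products being 1 − ∑_{k<n} (x;q)ₖ x qᵏ.  The case a = 0 exhibits an inverse
-- of (z;q)_∞, so this product is bounded away from 0.

module Submission where

open import Algebra.Bundles using (CommutativeRing)
import Algebra.Definitions.RawSemiring as RawSemiringDefinitions
import Algebra.Solver.Ring
open import Algebra.Solver.Ring.AlmostCommutativeRing
  using (fromCommutativeRing; _-Raw-AlmostCommutative⟶_)
open import Algebra.Structures using (IsCommutativeRing)
open import Data.Empty using (⊥-elim)
open import Data.Maybe.Base as Maybe using (Maybe)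
open import Data.Nat.Base as ℕ using (ℕ; zero; suc)
import Data.Nat.Properties as ℕ
open import Data.Product using (Σ-syntax; ∃-syntax; _×_; _,_; proj₁; proj₂)
open import Data.Rational.Base as ℚ using (ℚ; 0ℚ; 1ℚ; ½)
import Data.Rational.Properties as ℚ
open import Data.Rational.Solver using (module +-*-Solver)
open import Data.Sum.Base using (inj₁; inj₂)
open import Defs using (inv; nat; *-pos; half-pos; half-<; half+half; inv-pos; *-cancel-inv;
  ≤-+ʳ; ≤-+ˡ; nonNeg-*; sqr-mono-<; archimedean)
open import Level using (0ℓ)
open import Relation.Binary.PropositionalEquality
  using (_≡_; refl; sym; trans; cong; cong₂; subst; subst₂)
open import Relation.Nullary using (yes; no)
open import Relation.Nullary.Decidable using (dec⇒maybe)

open RawSemiringDefinitions ℚ.+-*-rawSemiring using () renaming (_^_ to _^ℚ_)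

-- The limits in N and k cannot simply be interchanged. At N-term partial sums, the defect of (z;q)ₖ
-- F(1) = (az;q)ₖ F(qᵏ) tends to 0 as N → ∞ for each fixed k, with no uniformity in k. The distance
-- of the partial sum of F(qᵏ) from 1, however, is at most a constant times rᵏ for every N ≥ 1,
-- because each term after the first contains a positive power of qᵏ. Hence N can be chosen as a
-- function of k, and only F(1) is ever formed as a limit.
--
-- Quotients come last. Recurrences are cleared of denominators, and the limit is obtained as
-- (z;q)_∞ s = (az;q)_∞, a form that applies to a = 0 before (z;q)_∞ is known to be invertible.
--
-- The argument runs in an abstract complete `NormedRing`. For ℂ its equality is eventual equality
-- of the approximating Gaussian rationals, so ring identities reduce to identities over ℚ. One
-- rational radius r < 1 bounds both z and q.

private
  module ℚ-Solver = +-*-Solver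

-- Properties that hold from some index on

Eventually : (ℕ → Set) → Set
Eventually P = ∃[ N ] ∀ n → N ℕ.≤ n → P n

always : ∀ {P : ℕ → Set} → (∀ n → P n) → Eventually P
always p = 0 , λ n _ → p n

eventually-map : ∀ {P Q : ℕ → Set} → (∀ n → P n → Q n) → Eventually P → Eventually Q
eventually-map f (N , p) = N , λ n N≤n → f n (p n N≤n)

eventually-zip : ∀ {P Q R : ℕ → Set} → (∀ n → P n → Q n → R n) →
                 Eventually P → Eventually Q → Eventually R
eventually-zip f (M , p) (N , q) = M ℕ.⊔ N , λ n M⊔N≤n →
  f n (p n (ℕ.m⊔n≤o⇒m≤o M N M⊔N≤n)) (q n (ℕ.m⊔n≤o⇒n≤o M N M⊔N≤n))

eventually-≥ : ∀ N → Eventually (N ℕ.≤_)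
eventually-≥ N = N , λ _ N≤n → N≤n

eventually-witness : ∀ {P : ℕ → Set} → Eventually P → ∃[ n ] P n
eventually-witness (N , p) = N , p N ℕ.≤-refl

-- Rational inequalities

0<1 : 0ℚ ℚ.< 1ℚ
0<1 = ℚ.positive⁻¹ 1ℚ

0≤1 : 0ℚ ℚ.≤ 1ℚ
0≤1 = ℚ.<⇒≤ 0<1

≤-by-difference : ∀ {p q} d → 0ℚ ℚ.≤ d → p ℚ.+ d ≡ q → p ℚ.≤ q
≤-by-difference {p} d 0≤d p+d≡q = subst (p ℚ.≤_) p+d≡q (≤-+ʳ p 0≤d)

0≤q-p : ∀ {p q} → p ℚ.≤ q → 0ℚ ℚ.≤ q ℚ.- p
0≤q-p {p} {q} p≤q = subst (ℚ._≤ q ℚ.- p) (ℚ.+-inverseʳ p) (ℚ.+-monoˡ-≤ (ℚ.- p) p≤q)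

0<q-p : ∀ {p q} → p ℚ.< q → 0ℚ ℚ.< q ℚ.- p
0<q-p {p} {q} p<q = subst (ℚ._< q ℚ.- p) (ℚ.+-inverseʳ p) (ℚ.+-monoˡ-< (ℚ.- p) p<q)

+-nonNeg : ∀ {p q} → 0ℚ ℚ.≤ p → 0ℚ ℚ.≤ q → 0ℚ ℚ.≤ p ℚ.+ q
+-nonNeg = ℚ.+-mono-≤

*-monoʳ-≤ : ∀ {p q} r → 0ℚ ℚ.≤ r → p ℚ.≤ q → r ℚ.* p ℚ.≤ r ℚ.* q
*-monoʳ-≤ r 0≤r = ℚ.*-monoˡ-≤-nonNeg r {{ℚ.nonNegative 0≤r}}

*-mono-≤ : ∀ {p q r s} → 0ℚ ℚ.≤ q → 0ℚ ℚ.≤ r → p ℚ.≤ q → r ℚ.≤ s → p ℚ.* r ℚ.≤ q ℚ.* s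
*-mono-≤ {p} {q} {r} {s} 0≤q 0≤r p≤q r≤s = ℚ.≤-trans
  (ℚ.*-monoʳ-≤-nonNeg r {{ℚ.nonNegative 0≤r}} p≤q) (*-monoʳ-≤ q 0≤q r≤s)

sqr-cancel-≤ : ∀ {p q} → 0ℚ ℚ.≤ q → p ℚ.* p ℚ.≤ q ℚ.* q → p ℚ.≤ q
sqr-cancel-≤ {p} {q} 0≤q p²≤q² with p ℚ.≤? q
... | yes p≤q = p≤q
... | no  p≰q = ⊥-elim (ℚ.<-irrefl refl (ℚ.<-≤-trans (sqr-mono-< 0≤q (ℚ.≰⇒> p≰q)) p²≤q²))

-- Decay of powers of a rational

module _ {r : ℚ} (0≤r : 0ℚ ℚ.≤ r) where

  ^-nonNeg : ∀ n → 0ℚ ℚ.≤ r ^ℚ n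
  ^-nonNeg zero    = 0≤1
  ^-nonNeg (suc n) = nonNeg-* 0≤r (^-nonNeg n)

  module _ (r≤1 : r ℚ.≤ 1ℚ) where

    ^-step-≤ : ∀ n → r ℚ.* r ^ℚ n ℚ.≤ r ^ℚ n
    ^-step-≤ n = subst (r ℚ.* r ^ℚ n ℚ.≤_) (ℚ.*-identityˡ (r ^ℚ n))
      (ℚ.*-monoʳ-≤-nonNeg (r ^ℚ n) {{ℚ.nonNegative (^-nonNeg n)}} r≤1)

    ^-≤1 : ∀ n → r ^ℚ n ℚ.≤ 1ℚ
    ^-≤1 zero    = ℚ.≤-refl
    ^-≤1 (suc n) = ℚ.≤-trans (^-step-≤ n) (^-≤1 n)

    ^-suc-≤ : ∀ n → r ^ℚ suc n ℚ.≤ r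
    ^-suc-≤ n = subst (r ^ℚ suc n ℚ.≤_) (ℚ.*-identityʳ r) (*-monoʳ-≤ r 0≤r (^-≤1 n))

    -- A weak form of Bernoulli's inequality for 1/r, cleared of denominators so that r = 0 is
    -- included. Passing from n to n + 1 lowers the left side by (1 - r)²(1 + n) rⁿ.
    bernoulli : ∀ n → (1ℚ ℚ.+ nat n ℚ.* (1ℚ ℚ.- r)) ℚ.* r ^ℚ n ℚ.≤ 1ℚ
    bernoulli zero    = ℚ.≤-reflexive (trans (ℚ.*-identityʳ _)
      (trans (cong (1ℚ ℚ.+_) (ℚ.*-zeroˡ (1ℚ ℚ.- r))) (ℚ.+-identityʳ 1ℚ)))
    bernoulli (suc n) = ℚ.≤-trans
      (≤-by-difference _
        (nonNeg-* (nonNeg-* (nonNeg-* 0≤1-r 0≤1-r) (+-nonNeg 0≤1 (nat-nonNeg n))) (^-nonNeg n))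
        (identity (nat n) r (r ^ℚ n)))
      (bernoulli n)
      where
      0≤1-r : 0ℚ ℚ.≤ 1ℚ ℚ.- r
      0≤1-r = 0≤q-p r≤1
      nat-nonNeg : ∀ n → 0ℚ ℚ.≤ nat n
      nat-nonNeg zero    = ℚ.≤-refl
      nat-nonNeg (suc n) = +-nonNeg 0≤1 (nat-nonNeg n)
      identity : ∀ m r p →
        (1ℚ ℚ.+ (1ℚ ℚ.+ m) ℚ.* (1ℚ ℚ.- r)) ℚ.* (r ℚ.* p)
          ℚ.+ (1ℚ ℚ.- r) ℚ.* (1ℚ ℚ.- r) ℚ.* (1ℚ ℚ.+ m) ℚ.* p
        ≡ (1ℚ ℚ.+ m ℚ.* (1ℚ ℚ.- r)) ℚ.* p
      identity = solve 3 (λ m r p →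
        (con 1ℚ :+ (con 1ℚ :+ m) :* (con 1ℚ :- r)) :* (r :* p)
          :+ (con 1ℚ :- r) :* (con 1ℚ :- r) :* (con 1ℚ :+ m) :* p
        := (con 1ℚ :+ m :* (con 1ℚ :- r)) :* p) refl
        where open ℚ-Solver

^-small : ∀ {r K ε} → 0ℚ ℚ.≤ r → r ℚ.< 1ℚ → 0ℚ ℚ.≤ K → 0ℚ ℚ.< ε →
          Eventually (λ n → K ℚ.* r ^ℚ n ℚ.≤ ε)
^-small {r} {K} {ε} 0≤r r<1 0≤K 0<ε = N , bound
  where
  h = 1ℚ ℚ.- r
  0<h : 0ℚ ℚ.< h
  0<h = 0<q-p r<1
  -- Bernoulli bounds rⁿ by 1/(1 + n h), so n ≥ K/(ε h) is late enough.
  L = K ℚ.* inv ε ℚ.* inv h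
  N = proj₁ (archimedean L)

  nat-mono : ∀ {m n} → m ℕ.≤ n → nat m ℚ.≤ nat n
  nat-mono {n = zero}  ℕ.z≤n       = ℚ.≤-refl
  nat-mono {n = suc n} ℕ.z≤n       = +-nonNeg 0≤1 (nat-mono (ℕ.z≤n {n}))
  nat-mono             (ℕ.s≤s m≤n) = ℚ.+-monoʳ-≤ 1ℚ (nat-mono m≤n)

  bound : ∀ n → N ℕ.≤ n → K ℚ.* r ^ℚ n ℚ.≤ ε
  bound n N≤n = begin
    K ℚ.* r ^ℚ n
      ≡⟨ cong (ℚ._* r ^ℚ n) (sym K≡) ⟩
    ε ℚ.* (L ℚ.* h) ℚ.* r ^ℚ n
      ≡⟨ ℚ.*-assoc ε (L ℚ.* h) (r ^ℚ n) ⟩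
    ε ℚ.* (L ℚ.* h ℚ.* r ^ℚ n)
      ≤⟨ *-monoʳ-≤ ε (ℚ.<⇒≤ 0<ε) (ℚ.*-monoʳ-≤-nonNeg (r ^ℚ n) {{ℚ.nonNegative (^-nonNeg 0≤r n)}}
           (ℚ.≤-trans
             (ℚ.*-monoʳ-≤-nonNeg h {{ℚ.nonNegative (ℚ.<⇒≤ 0<h)}}
               (ℚ.≤-trans (proj₂ (archimedean L)) (nat-mono N≤n)))
             (≤-+ˡ (nat n ℚ.* h) 0≤1))) ⟩
    ε ℚ.* ((1ℚ ℚ.+ nat n ℚ.* h) ℚ.* r ^ℚ n)
      ≤⟨ *-monoʳ-≤ ε (ℚ.<⇒≤ 0<ε) (bernoulli 0≤r (ℚ.<⇒≤ r<1) n) ⟩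
    ε ℚ.* 1ℚ
      ≡⟨ ℚ.*-identityʳ ε ⟩
    ε ∎
    where
    open ℚ.≤-Reasoning
    K≡ : ε ℚ.* (L ℚ.* h) ≡ K
    K≡ = trans (cong (ε ℚ.*_) (trans (ℚ.*-comm L h) (*-cancel-inv (K ℚ.* inv ε) 0<h)))
               (*-cancel-inv K 0<ε)

-- With t = (1 + r) / 2, both sides of the bound tend to r < t as n → ∞.
ratio-bound : ∀ {r α} → 0ℚ ℚ.< r → r ℚ.< 1ℚ → 0ℚ ℚ.≤ α →
  ∃[ t ] 0ℚ ℚ.< t × t ℚ.< 1ℚ ×
    Eventually (λ n → r ℚ.* (1ℚ ℚ.+ α ℚ.* r ^ℚ n) ℚ.≤ (1ℚ ℚ.- r ℚ.* r ^ℚ n) ℚ.* t)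
ratio-bound {r} {α} 0<r r<1 0≤α =
  t , half-pos (ℚ.+-mono-< 0<1 0<r) ,
  subst₂ ℚ._<_ refl (half+half 1ℚ)
    (subst (ℚ._< 1ℚ ℚ.* ½ ℚ.+ 1ℚ ℚ.* ½) (sym (ℚ.*-distribʳ-+ ½ 1ℚ r))
      (ℚ.+-monoʳ-< (1ℚ ℚ.* ½) (ℚ.*-monoˡ-<-pos ½ r<1))) ,
  -- Right side minus left side is (1 - r)/2 - (α + 1) rⁿ plus a nonnegative multiple of rⁿ, so it
  -- suffices that (α + 1) rⁿ ≤ (1 - r)/2.
  eventually-map (λ n small → ≤-by-difference _
      (+-nonNeg (0≤q-p small)
        (nonNeg-* (^-nonNeg 0≤r n)
          (+-nonNeg (nonNeg-* 0≤α 0≤h) (+-nonNeg 0≤h (nonNeg-* 0≤r (nonNeg-* 0≤h (ℚ.<⇒≤ (ℚ.positive⁻¹ ½))))))))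
      (identity r α (r ^ℚ n)))
    (^-small 0≤r r<1 (+-nonNeg 0≤α 0≤1) (half-pos (0<q-p r<1)))
  where
  t = (1ℚ ℚ.+ r) ℚ.* ½
  0≤r : 0ℚ ℚ.≤ r
  0≤r = ℚ.<⇒≤ 0<r
  0≤h : 0ℚ ℚ.≤ 1ℚ ℚ.- r
  0≤h = 0≤q-p (ℚ.<⇒≤ r<1)
  identity : ∀ r α p →
    r ℚ.* (1ℚ ℚ.+ α ℚ.* p) ℚ.+
      (((1ℚ ℚ.- r) ℚ.* ½ ℚ.- (α ℚ.+ 1ℚ) ℚ.* p) ℚ.+
       p ℚ.* (α ℚ.* (1ℚ ℚ.- r) ℚ.+ ((1ℚ ℚ.- r) ℚ.+ r ℚ.* ((1ℚ ℚ.- r) ℚ.* ½))))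
    ≡ (1ℚ ℚ.- r ℚ.* p) ℚ.* ((1ℚ ℚ.+ r) ℚ.* ½)
  identity = solve 3 (λ r α p →
    r :* (con 1ℚ :+ α :* p) :+
      (((con 1ℚ :- r) :* con ½ :- (α :+ con 1ℚ) :* p) :+
       p :* (α :* (con 1ℚ :- r) :+ ((con 1ℚ :- r) :+ r :* ((con 1ℚ :- r) :* con ½))))
    := (con 1ℚ :- r :* p) :* ((con 1ℚ :+ r) :* con ½)) refl
    where open ℚ-Solver

-- The norm is given only through its rational upper bounds, ∥ x ∥≤ r.
-- Zero and one are images of rationals so that the ring solver can use
-- rational coefficients.
record NormedRing : Set₁ where
  infix  4 _≈_ ∥_∥≤_
  infixl 6 _+_
  infixl 7 _*_
  infix  8 -_
  field
    Carrier : Set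
    _≈_     : Carrier → Carrier → Set
    _+_ _*_ : Carrier → Carrier → Carrier
    -_      : Carrier → Carrier
    fromℚ   : ℚ → Carrier

    isCommutativeRing : IsCommutativeRing _≈_ _+_ _*_ -_ (fromℚ 0ℚ) (fromℚ 1ℚ)
    fromℚ-+ : ∀ p q → fromℚ (p ℚ.+ q) ≈ fromℚ p + fromℚ q
    fromℚ-* : ∀ p q → fromℚ (p ℚ.* q) ≈ fromℚ p * fromℚ q
    fromℚ-neg : ∀ p → fromℚ (ℚ.- p) ≈ - fromℚ p

    ∥_∥≤_     : Carrier → ℚ → Set
    ∥∥-nonNeg : ∀ {x r} → ∥ x ∥≤ r → 0ℚ ℚ.≤ r
    ∥∥-mono   : ∀ {x r s} → r ℚ.≤ s → ∥ x ∥≤ r → ∥ x ∥≤ s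
    ∥∥-resp   : ∀ {x y r} → x ≈ y → ∥ x ∥≤ r → ∥ y ∥≤ r
    ∥0∥       : ∥ fromℚ 0ℚ ∥≤ 0ℚ
    ∥1∥       : ∥ fromℚ 1ℚ ∥≤ 1ℚ
    ∥+∥       : ∀ {x y r s} → ∥ x ∥≤ r → ∥ y ∥≤ s → ∥ x + y ∥≤ r ℚ.+ s
    ∥*∥       : ∀ {x y r s} → ∥ x ∥≤ r → ∥ y ∥≤ s → ∥ x * y ∥≤ r ℚ.* s
    ∥-∥       : ∀ {x r} → ∥ x ∥≤ r → ∥ - x ∥≤ r
    bounded   : ∀ x → ∃[ r ] ∥ x ∥≤ r
    ∥∥-cancel : ∀ {x y r s} → 0ℚ ℚ.≤ s → r ℚ.< 1ℚ → ∥ y ∥≤ r →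
                ∥ x * (fromℚ 1ℚ + - y) ∥≤ (1ℚ ℚ.- r) ℚ.* s → ∥ x ∥≤ s
    complete  : ∀ (f : ℕ → Carrier) →
                (∀ ε → 0ℚ ℚ.< ε →
                  ∃[ N ] ∀ m n → N ℕ.≤ m → N ℕ.≤ n → ∥ f m + - f n ∥≤ ε) →
                ∃[ l ] (∀ ε → 0ℚ ℚ.< ε → Eventually (λ n → ∥ f n + - l ∥≤ ε))

-- Null sequences and geometrically bounded series in a complete normed ring

module NullSequences (V : NormedRing) where

  open NormedRing V hiding (_≈_; _+_; _*_; -_)

  commutativeRing : CommutativeRing 0ℓ 0ℓ
  commutativeRing = record { isCommutativeRing = isCommutativeRing }

  open CommutativeRing commutativeRing public
    using (_≈_; _+_; _*_; -_; _-_; 0#; 1#; setoid; *-cong; *-congˡ; *-congʳ;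
           +-cong; +-congˡ; +-congʳ; -‿cong; *-identityˡ; *-identityʳ; +-identityˡ; -‿inverseʳ)
    renaming (refl to ≈-refl; sym to ≈-sym; trans to ≈-trans; reflexive to ≈-reflexive)
  open import Algebra.Properties.CommutativeSemiring.Exp
    (CommutativeRing.commutativeSemiring commutativeRing) public using (_^_; ^-distrib-*)

  fromℚ-homomorphism : ℚ.+-*-rawRing -Raw-AlmostCommutative⟶ fromCommutativeRing commutativeRing
  fromℚ-homomorphism = record
    { ⟦_⟧    = fromℚ
    ; +-homo = fromℚ-+
    ; *-homo = fromℚ-*
    ; -‿homo = fromℚ-neg
    ; 0-homo = ≈-refl
    ; 1-homo = ≈-refl
    }

  fromℚ-≟ : ∀ p q → Maybe (fromℚ p ≈ fromℚ q)
  fromℚ-≟ p q = Maybe.map (λ p≡q → ≈-reflexive (cong fromℚ p≡q)) (dec⇒maybe (p ℚ.≟ q))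

  module RingSolver = Algebra.Solver.Ring ℚ.+-*-rawRing
    (fromCommutativeRing commutativeRing) fromℚ-homomorphism fromℚ-≟

  open import Relation.Binary.Reasoning.Setoid setoid public

  1-[1-x]≈x : ∀ x → 1# - (1# - x) ≈ x
  1-[1-x]≈x = solve 1 (λ x → con 1ℚ :- (con 1ℚ :- x) := x) ≈-refl
    where open RingSolver

  ∑ : ℕ → (ℕ → Carrier) → Carrier
  ∑ zero    f = 0#
  ∑ (suc n) f = ∑ n f + f n

  ∑-cong : ∀ {f g} → (∀ n → f n ≈ g n) → ∀ n → ∑ n f ≈ ∑ n g
  ∑-cong f≈g zero    = ≈-refl
  ∑-cong f≈g (suc n) = +-cong (∑-cong f≈g n) (f≈g n)

  ∥^∥ : ∀ {x r} → ∥ x ∥≤ r → ∀ n → ∥ x ^ n ∥≤ r ^ℚ n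
  ∥^∥ x≤r zero    = ∥1∥
  ∥^∥ x≤r (suc n) = ∥*∥ x≤r (∥^∥ x≤r n)

  ∥∥-sub : ∀ {x y r s} → ∥ x ∥≤ r → ∥ y ∥≤ s → ∥ x - y ∥≤ r ℚ.+ s
  ∥∥-sub x≤r y≤s = ∥+∥ x≤r (∥-∥ y≤s)

  Null : (ℕ → Carrier) → Set
  Null f = ∀ ε → 0ℚ ℚ.< ε → Eventually (λ n → ∥ f n ∥≤ ε)

  module _ {f g : ℕ → Carrier} where

    null-resp : (∀ n → f n ≈ g n) → Null f → Null g
    null-resp f≈g f→0 ε 0<ε = eventually-map (λ n → ∥∥-resp (f≈g n)) (f→0 ε 0<ε)

    null-+ : Null f → Null g → Null (λ n → f n + g n)
    null-+ f→0 g→0 ε 0<ε = eventually-zip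
      (λ n f≤ g≤ → ∥∥-mono (ℚ.≤-reflexive (half+half ε)) (∥+∥ f≤ g≤))
      (f→0 (ε ℚ.* ½) (half-pos 0<ε)) (g→0 (ε ℚ.* ½) (half-pos 0<ε))

    null-* : Null f → Null g → Null (λ n → f n * g n)
    null-* f→0 g→0 ε 0<ε = eventually-zip
      (λ n f≤ g≤ → ∥∥-mono (ℚ.≤-reflexive (ℚ.*-identityˡ ε)) (∥*∥ f≤ g≤))
      (f→0 1ℚ 0<1) (g→0 ε 0<ε)

    null-bounded-* : ∀ {B} → (∀ n → ∥ f n ∥≤ B) → Null g → Null (λ n → f n * g n)
    null-bounded-* {B} f≤B g→0 ε 0<ε = eventually-map
      (λ n g≤ → ∥∥-mono (ℚ.≤-reflexive (*-cancel-inv ε 0<1+B)) (∥*∥ (∥∥-mono (≤-+ˡ B 0≤1) (f≤B n)) g≤))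
      -- Dividing by 1 + B instead of B covers the case B = 0.
      (g→0 (ε ℚ.* inv (1ℚ ℚ.+ B)) (*-pos 0<ε (inv-pos 0<1+B)))
      where
      0<1+B : 0ℚ ℚ.< 1ℚ ℚ.+ B
      0<1+B = ℚ.<-≤-trans 0<1 (≤-+ʳ 1ℚ (∥∥-nonNeg (f≤B 0)))

  null-0 : Null (λ _ → 0#)
  null-0 ε 0<ε = always (λ _ → ∥∥-mono (ℚ.<⇒≤ 0<ε) ∥0∥)

  null-neg : ∀ {f} → Null f → Null (λ n → - f n)
  null-neg f→0 ε 0<ε = eventually-map (λ n → ∥-∥) (f→0 ε 0<ε)

  null-scale : ∀ x {g} → Null g → Null (λ n → x * g n)
  null-scale x = null-bounded-* (λ _ → proj₂ (bounded x))

  null-geometric : ∀ {f C r} → 0ℚ ℚ.≤ C → 0ℚ ℚ.≤ r → r ℚ.< 1ℚ →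
                   (∀ n → ∥ f n ∥≤ C ℚ.* r ^ℚ n) → Null f
  null-geometric 0≤C 0≤r r<1 f≤ ε 0<ε =
    eventually-map (λ n small → ∥∥-mono small (f≤ n)) (^-small 0≤r r<1 0≤C 0<ε)

  -- Strict positivity of `t` lets `geometric-unshift` divide by it.
  record Geometric (f : ℕ → Carrier) : Set where
    field
      C t   : ℚ
      0≤C   : 0ℚ ℚ.≤ C
      0<t   : 0ℚ ℚ.< t
      t<1   : t ℚ.< 1ℚ
      bound : ∀ n → ∥ f n ∥≤ C ℚ.* t ^ℚ n

    0≤t : 0ℚ ℚ.≤ t
    0≤t = ℚ.<⇒≤ 0<t

    null : Null f
    null = null-geometric 0≤C 0≤t t<1 bound

    -- The constant of the geometric tail: ∑ₙ≥ₘ C tⁿ = H tᵐ.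
    H : ℚ
    H = C ℚ.* inv (1ℚ ℚ.- t)

    0≤H : 0ℚ ℚ.≤ H
    0≤H = nonNeg-* 0≤C (ℚ.<⇒≤ (inv-pos (0<q-p t<1)))

    C≡ : C ≡ (1ℚ ℚ.- t) ℚ.* H
    C≡ = sym (*-cancel-inv C (0<q-p t<1))

  -- Each term is bounded by the drop K tⁿ - K tⁿ⁺¹, so the bounds telescope; the induction in `go`
  -- carries the sharper K tᵐ - K tⁿ. Leaving K free allows `S-1` to put in an extra factor rᵏ.
  tail-bound : ∀ {f K t} → 0ℚ ℚ.≤ t → 0ℚ ℚ.≤ K → ∀ m →
               (∀ n → m ℕ.≤ n → ∥ f n ∥≤ (1ℚ ℚ.- t) ℚ.* K ℚ.* t ^ℚ n) →
               ∀ {n} → m ℕ.≤ n → ∥ ∑ n f - ∑ m f ∥≤ K ℚ.* t ^ℚ m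
  tail-bound {f} {K} {t} 0≤t 0≤K m f≤ {n} m≤n = ∥∥-mono
    (≤-by-difference _ (nonNeg-* 0≤K (^-nonNeg 0≤t n)) (p+q (K ℚ.* t ^ℚ m) (K ℚ.* t ^ℚ n)))
    (go (ℕ.≤⇒≤′ m≤n))
    where
    p+q : ∀ p q → (p ℚ.- q) ℚ.+ q ≡ p
    p+q = solve 2 (λ p q → (p :- q) :+ q := p) refl
      where open ℚ-Solver

    step : ∀ K t p p′ → K ℚ.* p ℚ.- K ℚ.* p′ ℚ.+ (1ℚ ℚ.- t) ℚ.* K ℚ.* p′ ≡
                        K ℚ.* p ℚ.- K ℚ.* (t ℚ.* p′)
    step = solve 4 (λ K t p p′ → K :* p :- K :* p′ :+ (con 1ℚ :- t) :* K :* p′ :=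
                                 K :* p :- K :* (t :* p′)) refl
      where open ℚ-Solver

    go : ∀ {n} → m ℕ.≤′ n → ∥ ∑ n f - ∑ m f ∥≤ K ℚ.* t ^ℚ m ℚ.- K ℚ.* t ^ℚ n
    go ℕ.≤′-refl = ∥∥-mono (ℚ.≤-reflexive (sym (ℚ.+-inverseʳ (K ℚ.* t ^ℚ m))))
      (∥∥-resp (solve 1 (λ x → con 0ℚ := x :- x) ≈-refl (∑ m f)) ∥0∥)
      where open RingSolver
    go {suc n} (ℕ.≤′-step m≤′n) = ∥∥-mono (ℚ.≤-reflexive (step K t (t ^ℚ m) (t ^ℚ n)))
      (∥∥-resp (solve 3 (λ x y z → (x :- y) :+ z := (x :+ z) :- y) ≈-refl (∑ n f) (∑ m f) (f n))
        (∥+∥ (go m≤′n) (f≤ n (ℕ.≤′⇒≤ m≤′n))))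
      where open RingSolver

  summable : ∀ {f} → Geometric f → ∃[ s ] Null (λ n → ∑ n f - s)
  summable {f} geom = complete (λ n → ∑ n f) cauchy
    where
    open Geometric geom
    tail : ∀ {m n} → m ℕ.≤ n → ∥ ∑ n f - ∑ m f ∥≤ H ℚ.* t ^ℚ m
    tail {m} = tail-bound 0≤t 0≤H m
      (λ n _ → ∥∥-mono (ℚ.≤-reflexive (cong (ℚ._* t ^ℚ n) C≡)) (bound n))

    cauchy : ∀ ε → 0ℚ ℚ.< ε → ∃[ N ] ∀ m n → N ℕ.≤ m → N ℕ.≤ n → ∥ ∑ m f - ∑ n f ∥≤ ε
    cauchy ε 0<ε = N , λ m n N≤m N≤n → ∥∥-mono (ℚ.≤-reflexive (half+half ε))
      (∥∥-resp (solve 3 (λ x y z → (x :- z) :- (y :- z) := x :- y) ≈-refl (∑ m f) (∑ n f) (∑ N f))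
        (∥∥-sub (∥∥-mono small (tail N≤m)) (∥∥-mono small (tail N≤n))))
      where
      open RingSolver
      witness = eventually-witness (^-small 0≤t t<1 0≤H (half-pos 0<ε))
      N = proj₁ witness
      small = proj₂ witness

  -- Initial terms are absorbed one at a time with `t` unchanged: C/t pays for the shift of the
  -- index by one, and a bound B of the new first term is added.
  geometric-unshift : ∀ {f} M → Geometric (λ n → f (M ℕ.+ n)) → Geometric f
  geometric-unshift zero geom = geom
  geometric-unshift {f} (suc M) geom = geometric-unshift M record
    { C = B ℚ.+ C ℚ.* inv t ; t = t
    ; 0≤C = +-nonNeg 0≤B (nonNeg-* 0≤C (ℚ.<⇒≤ (inv-pos 0<t))) ; 0<t = 0<t ; t<1 = t<1
    ; bound = λ where
        zero → ∥∥-mono (ℚ.≤-trans (≤-+ʳ B 0≤C/t) (ℚ.≤-reflexive (sym (ℚ.*-identityʳ _)))) f≤B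
        (suc n) → ∥∥-mono
          (ℚ.≤-trans (ℚ.≤-reflexive (shift n))
            (ℚ.*-monoʳ-≤-nonNeg (t ^ℚ suc n) {{ℚ.nonNegative (^-nonNeg 0≤t (suc n))}} (≤-+ˡ _ 0≤B)))
          (∥∥-resp (≈-reflexive (cong f (sym (ℕ.+-suc M n)))) (bound n))
    }
    where
    open Geometric geom
    B = proj₁ (bounded (f (M ℕ.+ 0)))
    f≤B = proj₂ (bounded (f (M ℕ.+ 0)))
    0≤B : 0ℚ ℚ.≤ B
    0≤B = ∥∥-nonNeg f≤B
    0≤C/t : 0ℚ ℚ.≤ C ℚ.* inv t
    0≤C/t = nonNeg-* 0≤C (ℚ.<⇒≤ (inv-pos 0<t))
    shift : ∀ n → C ℚ.* t ^ℚ n ≡ C ℚ.* inv t ℚ.* (t ℚ.* t ^ℚ n)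
    shift n = trans (cong (ℚ._* t ^ℚ n) (sym (*-cancel-inv C 0<t)))
      (swap t (C ℚ.* inv t) (t ^ℚ n))
      where
      open ℚ-Solver
      swap : ∀ a b c → a ℚ.* b ℚ.* c ≡ b ℚ.* (a ℚ.* c)
      swap = solve 3 (λ a b c → a :* b :* c := b :* (a :* c)) refl

-- The q-binomial theorem in a complete normed ring

module QSeries (V : NormedRing) where

  open NormedRing V using (Carrier; ∥_∥≤_; ∥∥-nonNeg; ∥∥-mono; ∥∥-resp; ∥0∥; ∥1∥; ∥*∥; ∥-∥;
                              bounded; ∥∥-cancel)
  open NullSequences V

  module Base {q : Carrier} {r : ℚ} (0<r : 0ℚ ℚ.< r) (r<1 : r ℚ.< 1ℚ) (q≤r : ∥ q ∥≤ r) where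

    0≤r : 0ℚ ℚ.≤ r
    0≤r = ℚ.<⇒≤ 0<r

    r≤1 : r ℚ.≤ 1ℚ
    r≤1 = ℚ.<⇒≤ r<1

    ∥q^∥≤1 : ∀ n → ∥ q ^ n ∥≤ 1ℚ
    ∥q^∥≤1 n = ∥∥-mono (^-≤1 0≤r r≤1 n) (∥^∥ q≤r n)

    -- The ratio test without quotients: `∥∥-cancel` divides by 1 - y n at the cost of a factor 1 -
    -- rⁿ⁺¹, which `ratio-bound` has already put into t. One recurrence serves two purposes: m = z,
    -- c = a, y n = qⁿ⁺¹ gives the series, and m = q, c = x, y n = 0 gives the differences of the
    -- partial products.
    geometric-ratio : ∀ {d y : ℕ → Carrier} {m} c → ∥ m ∥≤ r → (∀ n → ∥ y n ∥≤ r ^ℚ suc n) →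
      (∀ n → d (suc n) * (1# - y n) ≈ d n * (m * (1# - c * q ^ n))) → Geometric d
    geometric-ratio {d} {y} {m} c m≤r y≤ rec = geometric-unshift M record
      { C = B ; t = t ; 0≤C = 0≤B ; 0<t = 0<t ; t<1 = t<1 ; bound = bound }
      where
      α = proj₁ (bounded c)
      ratio = ratio-bound 0<r r<1 (∥∥-nonNeg (proj₂ (bounded c)))
      t = proj₁ ratio
      0<t = proj₁ (proj₂ ratio)
      t<1 = proj₁ (proj₂ (proj₂ ratio))
      M = proj₁ (proj₂ (proj₂ (proj₂ ratio)))
      ratio≤ = proj₂ (proj₂ (proj₂ (proj₂ ratio)))
      B = proj₁ (bounded (d (M ℕ.+ 0)))
      d≤B = proj₂ (bounded (d (M ℕ.+ 0)))
      0≤B : 0ℚ ℚ.≤ B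
      0≤B = ∥∥-nonNeg d≤B

      step : ∀ {s} n → M ℕ.≤ n → ∥ d n ∥≤ s → ∥ d (suc n) ∥≤ t ℚ.* s
      step {s} n M≤n d≤s = ∥∥-cancel (nonNeg-* (ℚ.<⇒≤ 0<t) 0≤s)
        (ℚ.≤-<-trans (^-suc-≤ 0≤r r≤1 n) r<1) (y≤ n)
        (∥∥-resp (≈-sym (rec n))
          (∥∥-mono
            (ℚ.≤-trans (*-monoʳ-≤ s 0≤s (ratio≤ n M≤n)) (ℚ.≤-reflexive (swap s (1ℚ ℚ.- r ^ℚ suc n) t)))
            (∥*∥ d≤s (∥*∥ m≤r (∥∥-sub ∥1∥ (∥*∥ (proj₂ (bounded c)) (∥^∥ q≤r n)))))))
        where
        0≤s : 0ℚ ℚ.≤ s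
        0≤s = ∥∥-nonNeg d≤s
        open ℚ-Solver
        swap : ∀ a b c → a ℚ.* (b ℚ.* c) ≡ b ℚ.* (c ℚ.* a)
        swap = solve 3 (λ a b c → a :* (b :* c) := b :* (c :* a)) refl

      bound : ∀ n → ∥ d (M ℕ.+ n) ∥≤ B ℚ.* t ^ℚ n
      bound zero    = ∥∥-mono (ℚ.≤-reflexive (sym (ℚ.*-identityʳ B))) d≤B
      bound (suc n) = ∥∥-mono (ℚ.≤-reflexive (swap t B (t ^ℚ n)))
        (∥∥-resp (≈-reflexive (cong d (sym (ℕ.+-suc M n)))) (step (M ℕ.+ n) (ℕ.m≤m+n M n) (bound n)))
        where
        open ℚ-Solver
        swap : ∀ a b c → a ℚ.* (b ℚ.* c) ≡ b ℚ.* (a ℚ.* c)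
        swap = solve 3 (λ a b c → a :* (b :* c) := b :* (a :* c)) refl

    -- Tying P to (x;q)ₙ only by its recursion admits the constant sequence 1 for x = 0, as
    -- `v-invertible` requires.
    record IsPoch (x : Carrier) (P : ℕ → Carrier) : Set where
      field
        base : P 0 ≈ 1#
        step : ∀ n → P (suc n) ≈ P n * (1# - x * q ^ n)

    poch-converges : ∀ {x P} → IsPoch x P → ∃[ p ] Null (λ n → P n - p)
    poch-converges {x} {P} poch = 1# - l , null-resp
      (λ n → ≈-trans (solve 3 (λ o S l → :- (S :- l) := (o :- S) :- (o :- l)) ≈-refl 1# (∑ n d) l)
                     (+-congʳ (≈-sym (telescope n))))
      (null-neg (proj₂ sum))
      where
      open IsPoch poch
      open RingSolver
      d : ℕ → Carrier
      d n = P n * (x * q ^ n)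
      sum = summable (geometric-ratio {d} {λ _ → 0#} x q≤r
        (λ n → ∥∥-mono (^-nonNeg 0≤r (suc n)) ∥0∥)
        (λ n → ≈-trans
          (*-congʳ (*-congʳ (step n)))
          (solve 4 (λ p x q y → (p :* (con 1ℚ :- x :* y)) :* (x :* (q :* y)) :* (con 1ℚ :- con 0ℚ)
                      := p :* (x :* y) :* (q :* (con 1ℚ :- x :* y))) ≈-refl (P n) x q (q ^ n))))
      l = proj₁ sum
      telescope : ∀ n → P n ≈ 1# - ∑ n d
      telescope zero    = ≈-trans base (solve 0 (con 1ℚ := con 1ℚ :- con 0ℚ) ≈-refl)
      telescope (suc n) = ≈-trans (step n) (≈-trans
        (solve 2 (λ p w → p :* (con 1ℚ :- w) := p :- p :* w) ≈-refl (P n) (x * q ^ n))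
        (≈-trans (+-congʳ (telescope n))
          (solve 3 (λ o S w → (o :- S) :- w := o :- (S :+ w)) ≈-refl 1# (∑ n d) (P n * (x * q ^ n)))))

    -- The ratio of consecutive terms, cleared of its denominator 1 - qⁿ⁺¹: from here on no inverse
    -- of (q;q)ₙ appears.
    record IsTerms (a z : Carrier) (T : ℕ → Carrier) : Set where
      field
        base : T 0 ≈ 1#
        step : ∀ n → T (suc n) * (1# - q * q ^ n) ≈ T n * (z * (1# - a * q ^ n))

    terms-geometric : ∀ {a z T} → ∥ z ∥≤ r → IsTerms a z T → Geometric T
    terms-geometric {a} z≤r terms = geometric-ratio a z≤r (λ n → ∥^∥ q≤r (suc n)) (IsTerms.step terms)

    quotient-terms : ∀ {a z A D T} {D⁻¹ : ℕ → Carrier} →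
      IsPoch a A → IsPoch q D → (∀ n → D n * D⁻¹ n ≈ 1#) → (∀ n → T n ≈ A n * z ^ n * D⁻¹ n) → IsTerms a z T
    quotient-terms {a} {z} {A} {D} {T} {D⁻¹} pochA pochD inverse T≈ = record
      { base = begin
          T 0                   ≈⟨ T≈ 0 ⟩
          A 0 * 1# * D⁻¹ 0      ≈⟨ *-congʳ (≈-trans (*-identityʳ _) (≈-trans A.base (≈-sym D.base))) ⟩
          D 0 * D⁻¹ 0           ≈⟨ inverse 0 ⟩
          1#                    ∎
      ; step = λ n → begin
          T (suc n) * (1# - q * q ^ n)
            ≈⟨ *-congʳ (≈-trans (T≈ (suc n)) (*-congʳ (*-congʳ (A.step n)))) ⟩
          A n * (1# - a * q ^ n) * (z * z ^ n) * D⁻¹ (suc n) * (1# - q * q ^ n)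
            ≈⟨ *-identityʳ _ ⟨
          A n * (1# - a * q ^ n) * (z * z ^ n) * D⁻¹ (suc n) * (1# - q * q ^ n) * 1#
            -- The inserted factor `D n` joins 1 - qⁿ⁺¹ to form `D (suc n)`, which then cancels
            -- `D⁻¹ (suc n)`.
            ≈⟨ *-congˡ (inverse n) ⟨
          A n * (1# - a * q ^ n) * (z * z ^ n) * D⁻¹ (suc n) * (1# - q * q ^ n) * (D n * D⁻¹ n)
            ≈⟨ solve 8 (λ A w z Z i o D j →
                 A :* w :* (z :* Z) :* i :* o :* (D :* j) := A :* Z :* j :* (z :* w) :* (D :* o :* i))
                 ≈-refl (A n) (1# - a * q ^ n) z (z ^ n) (D⁻¹ (suc n)) (1# - q * q ^ n) (D n) (D⁻¹ n) ⟩
          A n * z ^ n * D⁻¹ n * (z * (1# - a * q ^ n)) * (D n * (1# - q * q ^ n) * D⁻¹ (suc n))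
            ≈⟨ *-congˡ (≈-trans (*-congʳ (≈-sym (D.step n))) (inverse (suc n))) ⟩
          A n * z ^ n * D⁻¹ n * (z * (1# - a * q ^ n)) * 1#
            ≈⟨ *-identityʳ _ ⟩
          A n * z ^ n * D⁻¹ n * (z * (1# - a * q ^ n))
            ≈⟨ *-congʳ (T≈ n) ⟨
          T n * (z * (1# - a * q ^ n)) ∎
      }
      where
      module A = IsPoch pochA
      module D = IsPoch pochD
      open RingSolver

    module QBinomial {a z : Carrier} {T P Q : ℕ → Carrier} {s u v : Carrier} (z≤r : ∥ z ∥≤ r)
      (terms : IsTerms a z T) (pochP : IsPoch z P) (pochQ : IsPoch (a * z) Q)
      (T→s : Null (λ n → ∑ n T - s)) (P→v : Null (λ n → P n - v)) (Q→u : Null (λ n → Q n - u))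
      where

      module T = IsTerms terms
      module P = IsPoch pochP
      module Q = IsPoch pochQ
      open Geometric (terms-geometric z≤r terms)

      -- The partial sums of F(y); the factor zⁿ is already contained in `T n`.
      S : Carrier → ℕ → Carrier
      S y N = ∑ N (λ n → T n * y ^ n)

      -- The coefficient of the boundary term yᴺ in the functional equation.
      W : ℕ → Carrier
      W N = T N * (1# - q ^ N)

      -- The recursion gives W (N + 1) = T N · z (1 - a qᴺ), so the change of the boundary term
      -- accounts exactly for the terms added on both sides. At N = 0 the boundary term vanishes
      -- because 1 - q⁰ = 0.
      functional-equation : ∀ y N →
        (1# - z * y) * S y N ≈ (1# - a * z * y) * S (q * y) N - W N * y ^ N
      functional-equation y zero =
        solve 4 (λ a z y t → (con 1ℚ :- z :* y) :* con 0ℚ :=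
          (con 1ℚ :- a :* z :* y) :* con 0ℚ :- (t :* (con 1ℚ :- con 1ℚ)) :* con 1ℚ) ≈-refl a z y (T 0)
        where open RingSolver
      functional-equation y (suc N) = begin
        (1# - z * y) * (S y N + T N * y ^ N)
          ≈⟨ solve 3 (λ w S e → w :* (S :+ e) := w :* S :+ w :* e) ≈-refl (1# - z * y) (S y N) (T N * y ^ N) ⟩
        (1# - z * y) * S y N + (1# - z * y) * (T N * y ^ N)
          ≈⟨ +-congʳ (functional-equation y N) ⟩
        ((1# - a * z * y) * S (q * y) N - W N * y ^ N) + (1# - z * y) * (T N * y ^ N)
          ≈⟨ solve 7 (λ a z y S t p Y →
               ((con 1ℚ :- a :* z :* y) :* S :- t :* (con 1ℚ :- p) :* Y) :+ (con 1ℚ :- z :* y) :* (t :* Y)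
               := (con 1ℚ :- a :* z :* y) :* (S :+ t :* (p :* Y)) :- t :* (z :* (con 1ℚ :- a :* p)) :* (y :* Y))
               ≈-refl a z y (S (q * y) N) (T N) (q ^ N) (y ^ N) ⟩
        (1# - a * z * y) * (S (q * y) N + T N * (q ^ N * y ^ N))
          - T N * (z * (1# - a * q ^ N)) * (y * y ^ N)
          ≈⟨ +-cong (*-congˡ (+-congˡ (*-congˡ (^-distrib-* q y N)))) (-‿cong (*-congʳ (T.step N))) ⟨
        (1# - a * z * y) * (S (q * y) N + T N * (q * y) ^ N)
          - T (suc N) * (1# - q * q ^ N) * (y * y ^ N) ∎
        where open RingSolver

      -- The defect of (z;q)ₖ F(1) = (az;q)ₖ F(qᵏ) at N-term partial sums.
      E : ℕ → ℕ → Carrier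
      E k N = P k * S 1# N - Q k * S (q ^ k) N

      -- By the functional equation at y = qᵏ, `E (suc k) N` is (1 - z qᵏ) `E k N` minus (az;q)ₖ
      -- `W N` qᵏᴺ. At k = 0 the power of q is 1, so the decay of the boundary term has to come from
      -- `T N`.
      E-null : ∀ k → Null (E k)
      E-null zero = null-resp
        (λ N → ≈-trans (solve 1 (λ S → con 0ℚ := con 1ℚ :* S :- con 1ℚ :* S) ≈-refl (S 1# N))
                       (+-cong (*-congʳ (≈-sym P.base)) (-‿cong (*-congʳ (≈-sym Q.base)))))
        null-0
        where open RingSolver
      E-null (suc k) = null-resp step
        (null-+ (null-scale (1# - z * q ^ k) (E-null k))
                (null-neg (null-scale (Q k) (null-bounded-* coefficient≤ null))))
        where
        open RingSolver
        coefficient≤ : ∀ N → ∥ (1# - q ^ N) * (q ^ k) ^ N ∥≤ (1ℚ ℚ.+ 1ℚ) ℚ.* 1ℚ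
        coefficient≤ N = ∥*∥ (∥∥-sub ∥1∥ (∥q^∥≤1 N))
          (∥∥-mono (^-≤1 0≤1 ℚ.≤-refl N) (∥^∥ (∥q^∥≤1 k) N))
        step : ∀ N → (1# - z * q ^ k) * E k N - Q k * ((1# - q ^ N) * (q ^ k) ^ N * T N) ≈ E (suc k) N
        step N = begin
          (1# - z * q ^ k) * E k N - Q k * ((1# - q ^ N) * (q ^ k) ^ N * T N)
            ≈⟨ solve 8 (λ w p S q S′ o y t →
                 w :* (p :* S :- q :* S′) :- q :* (o :* y :* t)
                 := p :* w :* S :- q :* (w :* S′ :+ t :* o :* y))
                 ≈-refl (1# - z * q ^ k) (P k) (S 1# N) (Q k) (S (q ^ k) N) (1# - q ^ N) ((q ^ k) ^ N) (T N) ⟩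
          P k * (1# - z * q ^ k) * S 1# N - Q k * ((1# - z * q ^ k) * S (q ^ k) N + W N * (q ^ k) ^ N)
            ≈⟨ +-congˡ (-‿cong (*-congˡ (+-congʳ (functional-equation (q ^ k) N)))) ⟩
          P k * (1# - z * q ^ k) * S 1# N
            - Q k * ((1# - a * z * q ^ k) * S (q ^ suc k) N - W N * (q ^ k) ^ N + W N * (q ^ k) ^ N)
            ≈⟨ +-congˡ (-‿cong (solve 4 (λ q w S e → q :* (w :* S :- e :+ e) := q :* w :* S) ≈-refl
                 (Q k) (1# - a * z * q ^ k) (S (q ^ suc k) N) (W N * (q ^ k) ^ N))) ⟩
          P k * (1# - z * q ^ k) * S 1# N - Q k * (1# - a * z * q ^ k) * S (q ^ suc k) N
            ≈⟨ +-cong (*-congʳ (P.step k)) (-‿cong (*-congʳ (Q.step k))) ⟨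
          E (suc k) N ∎

      -- The term of index 0 is 1, and every later one carries (qᵏ)ⁿ with n ≥ 1, of norm at most rᵏ.
      -- The bound does not depend on N, which is what permits N to vary with k.
      S-1 : ∀ k {N} → 1 ℕ.≤ N → ∥ S (q ^ k) N - 1# ∥≤ H ℚ.* r ^ℚ k
      S-1 k 1≤N = ∥∥-resp (+-congˡ (-‿cong first))
        (∥∥-mono
          (ℚ.≤-trans (*-monoʳ-≤ (H ℚ.* r ^ℚ k) 0≤Hr^k (^-≤1 0≤t (ℚ.<⇒≤ t<1) 1))
                     (ℚ.≤-reflexive (ℚ.*-identityʳ _)))
          (tail-bound 0≤t 0≤Hr^k 1 terms≤ 1≤N))
        where
        0≤Hr^k : 0ℚ ℚ.≤ H ℚ.* r ^ℚ k
        0≤Hr^k = nonNeg-* 0≤H (^-nonNeg 0≤r k)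
        first : 0# + T 0 * 1# ≈ 1#
        first = ≈-trans (+-identityˡ _) (≈-trans (*-identityʳ _) T.base)
        terms≤ : ∀ n → 1 ℕ.≤ n →
          ∥ T n * (q ^ k) ^ n ∥≤ (1ℚ ℚ.- t) ℚ.* (H ℚ.* r ^ℚ k) ℚ.* t ^ℚ n
        terms≤ (suc n) _ = ∥∥-mono
          (ℚ.≤-trans
            (*-monoʳ-≤ (C ℚ.* t ^ℚ suc n) (nonNeg-* 0≤C (^-nonNeg 0≤t (suc n)))
              (^-suc-≤ (^-nonNeg 0≤r k) (^-≤1 0≤r r≤1 k) n))
            (ℚ.≤-reflexive (trans (cong (λ c → c ℚ.* t ^ℚ suc n ℚ.* r ^ℚ k) C≡)
              (arrange (1ℚ ℚ.- t) H (t ^ℚ suc n) (r ^ℚ k)))))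
          (∥*∥ (bound (suc n)) (∥^∥ (∥^∥ q≤r k) (suc n)))
          where
          open ℚ-Solver
          arrange : ∀ a b c d → a ℚ.* b ℚ.* c ℚ.* d ≡ a ℚ.* (b ℚ.* d) ℚ.* c
          arrange = solve 4 (λ a b c d → a :* b :* c :* d := a :* (b :* d) :* c) refl

      S1→s : Null (λ n → S 1# n - s)
      S1→s = null-resp (λ n → +-congʳ (∑-cong (λ k → ≈-sym (≈-trans (*-congˡ (1^ k)) (*-identityʳ _))) n)) T→s
        where
        1^ : ∀ n → 1# ^ n ≈ 1#
        1^ zero    = ≈-refl
        1^ (suc n) = ≈-trans (*-identityˡ _) (1^ n)

      -- With N = N(k) large, v s − u is split along
      --   (z;q)ₖ s − (az;q)ₖ = [E k N − (z;q)ₖ (S 1 N − s)] + (az;q)ₖ (S qᵏ N − 1).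
      q-binomial : ∀ ε → 0ℚ ℚ.< ε → ∥ v * s - u ∥≤ ε
      -- `split` equates a null sequence in k with the constant v s - u, so a single late k yields
      -- the bound.
      q-binomial ε 0<ε = proj₂ (eventually-witness (null-resp split
        (null-+ (null-+ (null-neg (null-scale s P→v)) Q→u)
          -- Writing `Q k * h k` as (Q k - u) h k + u h k uses the convergence of Q in place of a
          -- uniform bound on it.
          (null-+ G→0 (null-+ (null-* Q→u h→0) (null-scale u h→0)))) ε 0<ε))
        where
        open RingSolver
        G : ℕ → ℕ → Carrier
        G k N = E k N - P k * (S 1# N - s)

        G-null : ∀ k → Null (G k)
        G-null k = null-+ (E-null k) (null-neg (null-scale (P k) S1→s))

        -- The limit in N is taken separately for each k, with tolerance ½ᵏ so that the chosen
        -- defects are null in k; N ≥ 1 is the condition of `S-1`.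
        choose : ∀ k → ∃[ N ] ∥ G k N ∥≤ ½ ^ℚ k × 1 ℕ.≤ N
        choose k = eventually-witness
          (eventually-zip (λ _ → _,_) (G-null k (½ ^ℚ k) (½^ℚ-pos k)) (eventually-≥ 1))
          where
          ½^ℚ-pos : ∀ k → 0ℚ ℚ.< ½ ^ℚ k
          ½^ℚ-pos zero    = 0<1
          ½^ℚ-pos (suc k) = *-pos (ℚ.positive⁻¹ ½) (½^ℚ-pos k)

        N : ℕ → ℕ
        N k = proj₁ (choose k)

        G→0 : Null (λ k → G k (N k))
        G→0 = null-geometric 0≤1 (ℚ.<⇒≤ (ℚ.positive⁻¹ ½)) (half-< 0<1)
          (λ k → ∥∥-mono (ℚ.≤-reflexive (sym (ℚ.*-identityˡ _))) (proj₁ (proj₂ (choose k))))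

        h : ℕ → Carrier
        h k = S (q ^ k) (N k) - 1#

        h→0 : Null h
        h→0 = null-geometric 0≤H 0≤r r<1 (λ k → S-1 k (proj₂ (proj₂ (choose k))))

        split : ∀ k →
          (- (s * (P k - v)) + (Q k - u)) + (G k (N k) + ((Q k - u) * h k + u * h k)) ≈ v * s - u
        split k = solve 7 (λ s p v q u S S′ →
          (:- (s :* (p :- v)) :+ (q :- u)) :+
            ((p :* S :- q :* S′) :- p :* (S :- s) :+ ((q :- u) :* (S′ :- con 1ℚ) :+ u :* (S′ :- con 1ℚ)))
          := v :* s :- u) ≈-refl s (P k) v (Q k) u (S 1# (N k)) (S (q ^ k) (N k))

    module Limits {z : Carrier} (z≤r : ∥ z ∥≤ r)
      {P : Carrier → ℕ → Carrier} (poch : ∀ x → IsPoch x (P x))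
      {T : Carrier → ℕ → Carrier} (terms : ∀ a → IsTerms a z (T a))
      where

      opaque
        sum : ∀ a → ∃[ s ] Null (λ n → ∑ n (T a) - s)
        sum a = summable (terms-geometric z≤r (terms a))

        poch∞ : ∀ x → ∃[ p ] Null (λ n → P x n - p)
        poch∞ x = poch-converges (poch x)

      s u : Carrier → Carrier
      s a = proj₁ (sum a)
      u x = proj₁ (poch∞ x)

      v : Carrier
      v = u z

      q-binomial : ∀ a Q u → IsPoch (a * z) Q → Null (λ n → Q n - u) →
                   ∀ ε → 0ℚ ℚ.< ε → ∥ v * s a - u ∥≤ ε
      q-binomial a Q u pochQ Q→u = QBinomial.q-binomial {a} {z} {T a} {P z} {Q} {s a} {u} {v}
        z≤r (terms a) (poch z) pochQ (proj₂ (sum a)) (proj₂ (poch∞ z)) Q→u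

      -- The case a = 0, in which (az;q)_∞ = 1.
      v-invertible : ∀ ε → 0ℚ ℚ.< ε → ∥ 1# - v * s 0# ∥≤ ε
      v-invertible ε 0<ε = ∥∥-resp
        (solve 1 (λ w → :- (w :- con 1ℚ) := con 1ℚ :- w) ≈-refl (v * s 0#))
        (∥-∥ (q-binomial 0# (λ _ → 1#) 1# unit unit-null ε 0<ε))
        where
        open RingSolver
        unit : IsPoch (0# * z) (λ _ → 1#)
        unit = record
          { base = ≈-refl
          ; step = λ n → solve 2 (λ z p → con 1ℚ := con 1ℚ :* (con 1ℚ :- con 0ℚ :* z :* p)) ≈-refl z (q ^ n)
          }
        unit-null : Null (λ _ → 1# - 1#)
        unit-null = null-resp {λ _ → 0#} {λ _ → 1# - 1#} (λ _ → ≈-sym (-‿inverseʳ 1#)) null-0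

      -- Multiply v s - u by `v⁻¹`. A bound by every ε is read as a constant null sequence, so that
      -- `null-scale` absorbs the size of `v⁻¹`.
      sum-quotient : ∀ a {v⁻¹ w} → v * v⁻¹ ≈ 1# → w ≈ u (a * z) * v⁻¹ → ∀ ε → 0ℚ ℚ.< ε → ∥ s a - w ∥≤ ε
      sum-quotient a {v⁻¹} {w} inverse w≈ ε 0<ε = proj₂ (eventually-witness
        (null-resp {λ _ → v⁻¹ * (v * s a - u (a * z))} {λ _ → s a - w} (λ _ → quotient)
          (null-scale v⁻¹ {λ _ → v * s a - u (a * z)} difference≤) ε 0<ε))
        where
        open RingSolver
        difference≤ : Null (λ _ → v * s a - u (a * z))
        difference≤ ε 0<ε = always λ _ →
          q-binomial a (P (a * z)) (u (a * z)) (poch (a * z)) (proj₂ (poch∞ (a * z))) ε 0<ε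
        quotient : v⁻¹ * (v * s a - u (a * z)) ≈ s a - w
        quotient = begin
          v⁻¹ * (v * s a - u (a * z))
            ≈⟨ solve 4 (λ i v s u → i :* (v :* s :- u) := v :* i :* s :- u :* i) ≈-refl v⁻¹ v (s a) (u (a * z)) ⟩
          v * v⁻¹ * s a - u (a * z) * v⁻¹
            ≈⟨ +-cong (*-congʳ inverse) (-‿cong (≈-sym w≈)) ⟩
          1# * s a - w
            ≈⟨ +-congʳ (*-identityˡ (s a)) ⟩
          s a - w ∎

open import Defs

-- Squared absolute values of Gaussian rationals

norm² : ℚ → ℚ → ℚ
norm² x y = x ℚ.* x ℚ.+ y ℚ.* y

sqr-nonNeg : ∀ x → 0ℚ ℚ.≤ x ℚ.* x
sqr-nonNeg x with ℚ.≤-total 0ℚ x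
... | inj₁ 0≤x = nonNeg-* 0≤x 0≤x
... | inj₂ x≤0 = subst (0ℚ ℚ.≤_) (neg-sqr x)
  (nonNeg-* (ℚ.neg-antimono-≤ x≤0) (ℚ.neg-antimono-≤ x≤0))
  where
  open ℚ-Solver
  neg-sqr : ∀ x → ℚ.- x ℚ.* ℚ.- x ≡ x ℚ.* x
  neg-sqr = solve 1 (λ x → (:- x) :* (:- x) := x :* x) refl

sqr-∣∣ : ∀ x → x ℚ.* x ≡ ℚ.∣ x ∣ ℚ.* ℚ.∣ x ∣
sqr-∣∣ x = trans (sym (ℚ.0≤p⇒∣p∣≡p (sqr-nonNeg x))) (ℚ.∣p*q∣≡∣p∣*∣q∣ x x)

norm²-nonNeg : ∀ x y → 0ℚ ℚ.≤ norm² x y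
norm²-nonNeg x y = +-nonNeg (sqr-nonNeg x) (sqr-nonNeg y)

-- The Brahmagupta-Fibonacci identity, in the exact shape to which products in ℂ compute termwise.
norm²-* : ∀ a b c d → norm² (a ℚ.* c ℚ.+ ℚ.- (b ℚ.* d)) (a ℚ.* d ℚ.+ b ℚ.* c) ≡ norm² a b ℚ.* norm² c d
norm²-* = solve 4 (λ a b c d →
  (a :* c :+ :- (b :* d)) :* (a :* c :+ :- (b :* d)) :+ (a :* d :+ b :* c) :* (a :* d :+ b :* c)
  := (a :* a :+ b :* b) :* (c :* c :+ d :* d)) refl
  where open ℚ-Solver

-- The triangle inequality without square roots: Lagrange's identity gives Cauchy-Schwarz in squared
-- form, and `sqr-cancel-≤` removes the squares because r s ≥ 0, whatever the sign of `dot`.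
norm²-+ : ∀ {r s} a b c d → 0ℚ ℚ.≤ r → 0ℚ ℚ.≤ s → norm² a b ℚ.≤ r ℚ.* r → norm² c d ℚ.≤ s ℚ.* s →
          norm² (a ℚ.+ c) (b ℚ.+ d) ℚ.≤ (r ℚ.+ s) ℚ.* (r ℚ.+ s)
norm²-+ {r} {s} a b c d 0≤r 0≤s ab≤ cd≤ = begin
  norm² (a ℚ.+ c) (b ℚ.+ d)
    ≡⟨ expand a b c d ⟩
  norm² a b ℚ.+ norm² c d ℚ.+ (dot ℚ.+ dot)
    ≤⟨ ℚ.+-mono-≤ (ℚ.+-mono-≤ ab≤ cd≤) (ℚ.+-mono-≤ cauchy-schwarz cauchy-schwarz) ⟩
  r ℚ.* r ℚ.+ s ℚ.* s ℚ.+ (r ℚ.* s ℚ.+ r ℚ.* s)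
    ≡⟨ square-+ r s ⟨
  (r ℚ.+ s) ℚ.* (r ℚ.+ s) ∎
  where
  open ℚ.≤-Reasoning
  dot = a ℚ.* c ℚ.+ b ℚ.* d
  expand : ∀ a b c d → norm² (a ℚ.+ c) (b ℚ.+ d) ≡
    norm² a b ℚ.+ norm² c d ℚ.+ ((a ℚ.* c ℚ.+ b ℚ.* d) ℚ.+ (a ℚ.* c ℚ.+ b ℚ.* d))
  expand = solve 4 (λ a b c d →
    (a :+ c) :* (a :+ c) :+ (b :+ d) :* (b :+ d) :=
    (a :* a :+ b :* b) :+ (c :* c :+ d :* d) :+ ((a :* c :+ b :* d) :+ (a :* c :+ b :* d))) refl
    where open ℚ-Solver
  lagrange : ∀ a b c d → (a ℚ.* c ℚ.+ b ℚ.* d) ℚ.* (a ℚ.* c ℚ.+ b ℚ.* d)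
    ℚ.+ (a ℚ.* d ℚ.- b ℚ.* c) ℚ.* (a ℚ.* d ℚ.- b ℚ.* c) ≡ norm² a b ℚ.* norm² c d
  lagrange = solve 4 (λ a b c d →
    (a :* c :+ b :* d) :* (a :* c :+ b :* d) :+ (a :* d :- b :* c) :* (a :* d :- b :* c)
    := (a :* a :+ b :* b) :* (c :* c :+ d :* d)) refl
    where open ℚ-Solver
  swap : ∀ r s → r ℚ.* r ℚ.* (s ℚ.* s) ≡ r ℚ.* s ℚ.* (r ℚ.* s)
  swap = solve 2 (λ r s → r :* r :* (s :* s) := r :* s :* (r :* s)) refl
    where open ℚ-Solver
  cauchy-schwarz : dot ℚ.≤ r ℚ.* s
  cauchy-schwarz = sqr-cancel-≤ (nonNeg-* 0≤r 0≤s) (begin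
    dot ℚ.* dot               ≤⟨ ≤-by-difference _ (sqr-nonNeg (a ℚ.* d ℚ.- b ℚ.* c)) (lagrange a b c d) ⟩
    norm² a b ℚ.* norm² c d   ≤⟨ *-mono-≤ (nonNeg-* 0≤r 0≤r) (norm²-nonNeg c d) ab≤ cd≤ ⟩
    r ℚ.* r ℚ.* (s ℚ.* s)     ≡⟨ swap r s ⟩
    r ℚ.* s ℚ.* (r ℚ.* s)     ∎)

∣re∣≤ : ∀ {r} x y → 0ℚ ℚ.≤ r → norm² x y ℚ.≤ r ℚ.* r → ℚ.∣ x ∣ ℚ.≤ r
∣re∣≤ {r} x y 0≤r xy≤ = sqr-cancel-≤ 0≤r
  (subst (ℚ._≤ r ℚ.* r) (sqr-∣∣ x) (ℚ.≤-trans (≤-+ʳ (x ℚ.* x) (sqr-nonNeg y)) xy≤))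

∣im∣≤ : ∀ {r} x y → 0ℚ ℚ.≤ r → norm² x y ℚ.≤ r ℚ.* r → ℚ.∣ y ∣ ℚ.≤ r
∣im∣≤ {r} x y 0≤r xy≤ = ∣re∣≤ y x 0≤r (subst (ℚ._≤ r ℚ.* r) (ℚ.+-comm (x ℚ.* x) (y ℚ.* y)) xy≤)

norm²-≤ : ∀ {r s} x y → 0ℚ ℚ.≤ r → 0ℚ ℚ.≤ s → ℚ.∣ x ∣ ℚ.≤ r → ℚ.∣ y ∣ ℚ.≤ s →
          norm² x y ℚ.≤ (r ℚ.+ s) ℚ.* (r ℚ.+ s)
norm²-≤ {r} {s} x y 0≤r 0≤s x≤r y≤s = ℚ.≤-trans
  (ℚ.+-mono-≤ (sqr≤ x 0≤r x≤r) (sqr≤ y 0≤s y≤s))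
  (≤-by-difference _ (+-nonNeg (nonNeg-* 0≤r 0≤s) (nonNeg-* 0≤r 0≤s)) (sym (square-+ r s)))
  where
  sqr≤ : ∀ {r} x → 0ℚ ℚ.≤ r → ℚ.∣ x ∣ ℚ.≤ r → x ℚ.* x ℚ.≤ r ℚ.* r
  sqr≤ {r} x 0≤r x≤r = subst (ℚ._≤ r ℚ.* r) (sym (sqr-∣∣ x)) (*-mono-≤ 0≤r (ℚ.0≤∣p∣ x) x≤r x≤r)

-- The real part alone suffices: x ≤ |x| ≤ r gives 1 - x ≥ 1 - r ≥ 0.
norm²-1- : ∀ {r} x y → 0ℚ ℚ.≤ r → r ℚ.< 1ℚ → norm² x y ℚ.≤ r ℚ.* r →
           (1ℚ ℚ.- r) ℚ.* (1ℚ ℚ.- r) ℚ.≤ norm² (1ℚ ℚ.- x) (0ℚ ℚ.- y)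
norm²-1- {r} x y 0≤r r<1 xy≤ = ℚ.≤-trans
  (*-mono-≤ (ℚ.≤-trans 0≤1-r 1-r≤1-x) 0≤1-r 1-r≤1-x 1-r≤1-x)
  (≤-+ʳ _ (sqr-nonNeg (0ℚ ℚ.- y)))
  where
  0≤1-r : 0ℚ ℚ.≤ 1ℚ ℚ.- r
  0≤1-r = 0≤q-p (ℚ.<⇒≤ r<1)
  1-r≤1-x : 1ℚ ℚ.- r ℚ.≤ 1ℚ ℚ.- x
  1-r≤1-x = ℚ.+-monoʳ-≤ 1ℚ (ℚ.neg-antimono-≤ (ℚ.≤-trans (≤∣∣ x) (∣re∣≤ x y 0≤r xy≤)))

-- Completeness of ℝ

dist-triangle : ∀ p q r → dist p r ℚ.≤ dist p q ℚ.+ dist q r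
dist-triangle p q r = subst (λ d → ℚ.∣ d ∣ ℚ.≤ dist p q ℚ.+ dist q r) (telescope p q r)
  (ℚ.∣p+q∣≤∣p∣+∣q∣ (p ℚ.- q) (q ℚ.- r))
  where
  open ℚ-Solver
  telescope : ∀ p q r → (p ℚ.- q) ℚ.+ (q ℚ.- r) ≡ p ℚ.- r
  telescope = solve 3 (λ p q r → (p :- q) :+ (q :- r) := p :- r) refl

-- The limit is a diagonal: its k-th term is a term of f k lying within ½ᵏ
-- of all later ones.
ℝ-complete : ∀ (f : ℕ → ℝ) →
  (∀ ε → 0ℚ ℚ.< ε → ∃[ N ] ∀ m n → N ℕ.≤ m → N ℕ.≤ n →
    Eventually (λ i → dist (seq (f m) i) (seq (f n) i) ℚ.≤ ε)) →
  ∃[ l ] ∀ ε → 0ℚ ℚ.< ε →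
    Eventually (λ n → Eventually (λ i → dist (seq (f n) i) (seq l i) ℚ.≤ ε))
ℝ-complete f f-cauchy = mkℝ l l-cauchy , converges
  where
  modulus : ∀ k → ∃[ N ] ∀ m n → N ℕ.≤ m → N ℕ.≤ n → dist (seq (f k) m) (seq (f k) n) ℚ.< ½^ k
  modulus k = cauchy (f k) (½^ k) (½^-pos k)

  l : ℕ → ℚ
  l k = seq (f k) (proj₁ (modulus k))

  converges : ∀ ε → 0ℚ ℚ.< ε →
    Eventually (λ n → Eventually (λ i → dist (seq (f n) i) (l i) ℚ.≤ ε))
  converges ε 0<ε = N , λ n N≤n →
    let I , fₙ-close = cauchy (f n) δ′ 0<δ′
    in eventually-zip (λ i (N≤i , I≤i) small →
         -- The detour runs through a common late index j of f n and f i: ε/4 for moving along f n,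
         -- ε/4 for passing to f i, and ½ⁱ < ε/2 for returning to the term of f i selected by `l`.
         let j , (I≤j , J≤j) , close = eventually-witness
               (eventually-zip (λ _ → _,_)
                 (eventually-zip (λ _ → _,_) (eventually-≥ I) (eventually-≥ (proj₁ (modulus i))))
                 (f-close n i N≤n N≤i))
         in begin
           dist (seq (f n) i) (l i)
             ≤⟨ dist-triangle (seq (f n) i) (seq (f i) j) (l i) ⟩
           dist (seq (f n) i) (seq (f i) j) ℚ.+ dist (seq (f i) j) (l i)
             ≤⟨ ℚ.+-monoˡ-≤ _ (dist-triangle (seq (f n) i) (seq (f n) j) (seq (f i) j)) ⟩
           dist (seq (f n) i) (seq (f n) j) ℚ.+ dist (seq (f n) j) (seq (f i) j) ℚ.+ dist (seq (f i) j) (l i)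
             ≤⟨ ℚ.+-mono-≤ (ℚ.+-mono-≤ (ℚ.<⇒≤ (fₙ-close i j I≤i I≤j)) close)
                  (ℚ.≤-trans (ℚ.<⇒≤ (proj₂ (modulus i) j (proj₁ (modulus i)) J≤j ℕ.≤-refl))
                    (ℚ.≤-trans (ℚ.≤-reflexive (sym (ℚ.*-identityˡ (½^ i)))) (ℚ.<⇒≤ small))) ⟩
           δ′ ℚ.+ δ′ ℚ.+ δ
             ≡⟨ cong (ℚ._+ δ) (half+half δ) ⟩
           δ ℚ.+ δ
             ≡⟨ half+half ε ⟩
           ε ∎)
       (eventually-zip (λ _ → _,_) (eventually-≥ N) (eventually-≥ I))
       (½^-small 0<1 0<δ)
    where
    open ℚ.≤-Reasoning
    δ δ′ : ℚ
    δ  = ε ℚ.* ½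
    δ′ = δ ℚ.* ½
    0<δ : 0ℚ ℚ.< δ
    0<δ = half-pos 0<ε
    0<δ′ : 0ℚ ℚ.< δ′
    0<δ′ = half-pos 0<δ
    N = proj₁ (f-cauchy δ′ 0<δ′)
    f-close = proj₂ (f-cauchy δ′ 0<δ′)

  -- `converges` speaks of the bare sequence `l`, so it can be used here: a single f M, eventually
  -- within ε/4 of `l` and itself Cauchy, passes the property on.
  l-cauchy : Cauchy l
  l-cauchy ε 0<ε = I , λ m n I≤m I≤n → begin-strict
    dist (l m) (l n)
      ≤⟨ dist-triangle (l m) (g n) (l n) ⟩
    dist (l m) (g n) ℚ.+ dist (g n) (l n)
      ≤⟨ ℚ.+-monoˡ-≤ _ (dist-triangle (l m) (g m) (g n)) ⟩
    dist (l m) (g m) ℚ.+ dist (g m) (g n) ℚ.+ dist (g n) (l n)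
      ≡⟨ cong (λ d → d ℚ.+ dist (g m) (g n) ℚ.+ dist (g n) (l n)) (dist-sym (l m) (g m)) ⟩
    dist (g m) (l m) ℚ.+ dist (g m) (g n) ℚ.+ dist (g n) (l n)
      <⟨ ℚ.+-mono-<-≤ (ℚ.+-mono-≤-< (near m (ℕ.m⊔n≤o⇒m≤o J K I≤m))
           (g-close m n (ℕ.m⊔n≤o⇒n≤o J K I≤m) (ℕ.m⊔n≤o⇒n≤o J K I≤n)))
           (near n (ℕ.m⊔n≤o⇒m≤o J K I≤n)) ⟩
    δ′ ℚ.+ δ ℚ.+ δ′
      ≡⟨ trans (cong (ℚ._+ δ′) (ℚ.+-comm δ′ δ)) (trans (ℚ.+-assoc δ δ′ δ′) (cong (δ ℚ.+_) (half+half δ))) ⟩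
    δ ℚ.+ δ
      ≡⟨ half+half ε ⟩
    ε ∎
    where
    open ℚ.≤-Reasoning
    δ δ′ : ℚ
    δ  = ε ℚ.* ½
    δ′ = δ ℚ.* ½
    M = proj₁ (eventually-witness (converges δ′ (half-pos (half-pos 0<ε))))
    near-M = proj₂ (eventually-witness (converges δ′ (half-pos (half-pos 0<ε))))
    g = seq (f M)
    J = proj₁ near-M
    near = proj₂ near-M
    K = proj₁ (cauchy (f M) δ (half-pos 0<ε))
    g-close = proj₂ (cauchy (f M) δ (half-pos 0<ε))
    I = J ℕ.⊔ K

-- The Gaussian rational approximations of a complex number

infix  4 _≐_ ∥_∥≤_
infixr 4 _&_

-- Ring identities between complex numbers hold eventually termwise, which is
-- stronger than _≈_ and needs no estimates.
record _≐_ (z w : ℂ) : Set where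
  constructor eventually
  field
    terms : Eventually (λ n → seq (re z) n ≡ seq (re w) n × seq (im z) n ≡ seq (im w) n)

-- The squared termwise form keeps every estimate inside ℚ; `nonNeg` makes r recoverable from r².
record ∥_∥≤_ (z : ℂ) (r : ℚ) : Set where
  constructor _&_
  field
    nonNeg : 0ℚ ℚ.≤ r
    bound  : Eventually (λ n → norm² (seq (re z) n) (seq (im z) n) ℚ.≤ r ℚ.* r)

constant : ℚ → ℂ
constant p = mkℂ (mkℝ (λ _ → p) (const-cauchy p)) 0ᴿ

termwise₁ : ∀ {P Q : ℚ → ℚ → Set} → (∀ a b → P a b) → (∀ a b → Q a b) → ∀ z →
  Eventually (λ n → P (seq (re z) n) (seq (im z) n) × Q (seq (re z) n) (seq (im z) n))
termwise₁ p q z = always λ n → p (seq (re z) n) (seq (im z) n) , q (seq (re z) n) (seq (im z) n)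

termwise₂ : ∀ {P Q : ℚ → ℚ → ℚ → ℚ → Set} →
  (∀ a b c d → P a b c d) → (∀ a b c d → Q a b c d) → ∀ z w →
  Eventually (λ n → P (seq (re z) n) (seq (im z) n) (seq (re w) n) (seq (im w) n) ×
                    Q (seq (re z) n) (seq (im z) n) (seq (re w) n) (seq (im w) n))
termwise₂ p q z w = always λ n →
  p (seq (re z) n) (seq (im z) n) (seq (re w) n) (seq (im w) n) ,
  q (seq (re z) n) (seq (im z) n) (seq (re w) n) (seq (im w) n)

termwise₃ : ∀ {P Q : ℚ → ℚ → ℚ → ℚ → ℚ → ℚ → Set} →
  (∀ a b c d e f → P a b c d e f) → (∀ a b c d e f → Q a b c d e f) → ∀ x y z →
  Eventually (λ n →
    P (seq (re x) n) (seq (im x) n) (seq (re y) n) (seq (im y) n) (seq (re z) n) (seq (im z) n) ×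
    Q (seq (re x) n) (seq (im x) n) (seq (re y) n) (seq (im y) n) (seq (re z) n) (seq (im z) n))
termwise₃ p q x y z = always λ n →
  p (seq (re x) n) (seq (im x) n) (seq (re y) n) (seq (im y) n) (seq (re z) n) (seq (im z) n) ,
  q (seq (re x) n) (seq (im x) n) (seq (re y) n) (seq (im y) n) (seq (re z) n) (seq (im z) n)

≐-isCommutativeRing : IsCommutativeRing _≐_ _+_ _*_ -_ 0ℂ 1ℂ
≐-isCommutativeRing = record
  { isRing = record
    { +-isAbelianGroup = record
      { isGroup = record
        { isMonoid = record
          { isSemigroup = record
            { isMagma = record
              { isEquivalence = record
                { refl  = eventually (always λ _ → refl , refl)
                ; sym   = λ (eventually e) → eventually (eventually-map (λ _ (p , q) → sym p , sym q) e)
                ; trans = λ (eventually e) (eventually e′) → eventually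
                    (eventually-zip (λ _ (p , q) (p′ , q′) → trans p p′ , trans q q′) e e′)
                }
              ; ∙-cong = λ (eventually e) (eventually e′) → eventually (eventually-zip
                  (λ _ (p , q) (p′ , q′) → cong₂ ℚ._+_ p p′ , cong₂ ℚ._+_ q q′) e e′)
              }
            ; assoc = (λ x y z → eventually
                (termwise₃ (λ a _ c _ e _ → ℚ.+-assoc a c e) (λ _ b _ d _ f → ℚ.+-assoc b d f) x y z))
            }
          ; identity = (λ x → eventually (termwise₁ (λ a _ → ℚ.+-identityˡ a) (λ _ b → ℚ.+-identityˡ b) x))
                     , (λ x → eventually (termwise₁ (λ a _ → ℚ.+-identityʳ a) (λ _ b → ℚ.+-identityʳ b) x))
          }
        ; inverse = (λ x → eventually (termwise₁ (λ a _ → ℚ.+-inverseˡ a) (λ _ b → ℚ.+-inverseˡ b) x))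
                  , (λ x → eventually (termwise₁ (λ a _ → ℚ.+-inverseʳ a) (λ _ b → ℚ.+-inverseʳ b) x))
        ; ⁻¹-cong = λ (eventually e) → eventually
            (eventually-map (λ _ (p , q) → cong ℚ.-_ p , cong ℚ.-_ q) e)
        }
      ; comm = (λ x y → eventually (termwise₂ (λ a _ c _ → ℚ.+-comm a c) (λ _ b _ d → ℚ.+-comm b d) x y))
      }
    ; *-cong = λ (eventually e) (eventually e′) → eventually (eventually-zip (λ _ (p , q) (p′ , q′) →
        cong₂ ℚ._+_ (cong₂ ℚ._*_ p p′) (cong ℚ.-_ (cong₂ ℚ._*_ q q′)) ,
        cong₂ ℚ._+_ (cong₂ ℚ._*_ p q′) (cong₂ ℚ._*_ q p′)) e e′)
    ; *-assoc = (λ x y z → eventually (termwise₃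
        (solve 6 (λ a b c d e f →
          (a :* c :+ :- (b :* d)) :* e :+ :- ((a :* d :+ b :* c) :* f) :=
          a :* (c :* e :+ :- (d :* f)) :+ :- (b :* (c :* f :+ d :* e))) refl)
        (solve 6 (λ a b c d e f →
          (a :* c :+ :- (b :* d)) :* f :+ (a :* d :+ b :* c) :* e :=
          a :* (c :* f :+ d :* e) :+ b :* (c :* e :+ :- (d :* f))) refl) x y z))
    ; *-identity =
        (λ x → eventually (termwise₁
          (solve 2 (λ a b → con 1ℚ :* a :+ :- (con 0ℚ :* b) := a) refl)
          (solve 2 (λ a b → con 1ℚ :* b :+ con 0ℚ :* a := b) refl) x)) ,
        (λ x → eventually (termwise₁
          (solve 2 (λ a b → a :* con 1ℚ :+ :- (b :* con 0ℚ) := a) refl)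
          (solve 2 (λ a b → a :* con 0ℚ :+ b :* con 1ℚ := b) refl) x))
    ; distrib =
        (λ x y z → eventually (termwise₃
          (solve 6 (λ a b c d e f → a :* (c :+ e) :+ :- (b :* (d :+ f)) :=
            (a :* c :+ :- (b :* d)) :+ (a :* e :+ :- (b :* f))) refl)
          (solve 6 (λ a b c d e f → a :* (d :+ f) :+ b :* (c :+ e) :=
            (a :* d :+ b :* c) :+ (a :* f :+ b :* e)) refl) x y z)) ,
        (λ x y z → eventually (termwise₃
          (solve 6 (λ a b c d e f → (c :+ e) :* a :+ :- ((d :+ f) :* b) :=
            (c :* a :+ :- (d :* b)) :+ (e :* a :+ :- (f :* b))) refl)
          (solve 6 (λ a b c d e f → (c :+ e) :* b :+ (d :+ f) :* a :=
            (c :* b :+ d :* a) :+ (e :* b :+ f :* a)) refl) x y z))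
    }
  ; *-comm = (λ x y → eventually (termwise₂
      (solve 4 (λ a b c d → a :* c :+ :- (b :* d) := c :* a :+ :- (d :* b)) refl)
      (solve 4 (λ a b c d → a :* d :+ b :* c := c :* b :+ d :* a) refl) x y))
  }
  where open ℚ-Solver

norm-bounded : ∀ z → ∃[ r ] ∥ z ∥≤ r
norm-bounded z
  with eventuallyBounded {seq (re z)} (cauchy (re z)) | eventuallyBounded {seq (im z)} (cauchy (im z))
... | B , 0<B , re≤ | C , 0<C , im≤ = B ℚ.+ C , +-nonNeg (ℚ.<⇒≤ 0<B) (ℚ.<⇒≤ 0<C) &
  eventually-zip (λ n → norm²-≤ (seq (re z) n) (seq (im z) n) (ℚ.<⇒≤ 0<B) (ℚ.<⇒≤ 0<C)) re≤ im≤

-- Termwise |z|²(1 - r)² ≤ |z|²|1 - w|² = |z(1 - w)|² ≤ (1 - r)² s², and the positive factor (1 -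
-- r)² cancels.
norm-cancel : ∀ {z w r s} → 0ℚ ℚ.≤ s → r ℚ.< 1ℚ → ∥ w ∥≤ r →
              ∥ z * (1ℂ - w) ∥≤ (1ℚ ℚ.- r) ℚ.* s → ∥ z ∥≤ s
norm-cancel {z} {w} {r} {s} 0≤s r<1 (0≤r & w≤) (_ & zw≤) = 0≤s & eventually-zip
  (λ n w≤ zw≤ → let a = seq (re z) n ; b = seq (im z) n ; c = seq (re w) n ; d = seq (im w) n in
    ℚ.*-cancelʳ-≤-pos (h ℚ.* h) {{ℚ.positive (*-pos 0<h 0<h)}} (begin
      norm² a b ℚ.* (h ℚ.* h)
        ≤⟨ *-monoʳ-≤ (norm² a b) (norm²-nonNeg a b) (norm²-1- c d 0≤r r<1 w≤) ⟩
      norm² a b ℚ.* norm² (1ℚ ℚ.- c) (0ℚ ℚ.- d)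
        ≡⟨ norm²-* a b (1ℚ ℚ.- c) (0ℚ ℚ.- d) ⟨
      norm² (a ℚ.* (1ℚ ℚ.- c) ℚ.+ ℚ.- (b ℚ.* (0ℚ ℚ.- d))) (a ℚ.* (0ℚ ℚ.- d) ℚ.+ b ℚ.* (1ℚ ℚ.- c))
        ≤⟨ zw≤ ⟩
      h ℚ.* s ℚ.* (h ℚ.* s)
        ≡⟨ swap h s ⟩
      s ℚ.* s ℚ.* (h ℚ.* h) ∎))
  w≤ zw≤
  where
  open ℚ.≤-Reasoning
  h = 1ℚ ℚ.- r
  0<h : 0ℚ ℚ.< h
  0<h = 0<q-p r<1
  swap : ∀ h s → h ℚ.* s ℚ.* (h ℚ.* s) ≡ s ℚ.* s ℚ.* (h ℚ.* h)
  swap = solve 2 (λ h s → h :* s :* (h :* s) := s :* s :* (h :* h)) refl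
    where open ℚ-Solver

ℂ-complete : ∀ (f : ℕ → ℂ) →
  (∀ ε → 0ℚ ℚ.< ε → ∃[ N ] ∀ m n → N ℕ.≤ m → N ℕ.≤ n → ∥ f m - f n ∥≤ ε) →
  ∃[ l ] ∀ ε → 0ℚ ℚ.< ε → Eventually (λ n → ∥ f n - l ∥≤ ε)
ℂ-complete f f-cauchy = mkℂ (proj₁ re-limit) (proj₁ im-limit) , λ ε 0<ε → eventually-zip
    (λ n re≤ im≤ → ℚ.<⇒≤ 0<ε & eventually-zip
      (λ i re≤ im≤ → subst (λ r → _ ℚ.≤ r ℚ.* r) (half+half ε)
        (norm²-≤ _ _ (ℚ.<⇒≤ (half-pos 0<ε)) (ℚ.<⇒≤ (half-pos 0<ε)) re≤ im≤))
      re≤ im≤)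
    (proj₂ re-limit (ε ℚ.* ½) (half-pos 0<ε)) (proj₂ im-limit (ε ℚ.* ½) (half-pos 0<ε))
  where
  re-limit = ℝ-complete (λ n → re (f n)) λ ε 0<ε →
    proj₁ (f-cauchy ε 0<ε) , λ m n N≤m N≤n →
      eventually-map (λ i → ∣re∣≤ _ (seq (im (f m - f n)) i) (ℚ.<⇒≤ 0<ε))
        (∥_∥≤_.bound (proj₂ (f-cauchy ε 0<ε) m n N≤m N≤n))
  im-limit = ℝ-complete (λ n → im (f n)) λ ε 0<ε →
    proj₁ (f-cauchy ε 0<ε) , λ m n N≤m N≤n →
      eventually-map (λ i → ∣im∣≤ (seq (re (f m - f n)) i) _ (ℚ.<⇒≤ 0<ε))
        (∥_∥≤_.bound (proj₂ (f-cauchy ε 0<ε) m n N≤m N≤n))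

ℂ-normedRing : NormedRing
ℂ-normedRing = record
  { Carrier = ℂ ; _≈_ = _≐_ ; _+_ = _+_ ; _*_ = _*_ ; -_ = -_ ; fromℚ = constant
  ; isCommutativeRing = ≐-isCommutativeRing
  ; fromℚ-+ = λ _ _ → eventually (always λ _ → refl , refl)
  ; fromℚ-* = λ p q → eventually (always λ _ →
      solve 2 (λ p q → p :* q := p :* q :+ :- (con 0ℚ :* con 0ℚ)) refl p q ,
      solve 2 (λ p q → con 0ℚ := p :* con 0ℚ :+ con 0ℚ :* q) refl p q)
  ; fromℚ-neg = λ _ → eventually (always λ _ → refl , refl)
  ; ∥_∥≤_ = ∥_∥≤_
  ; ∥∥-nonNeg = ∥_∥≤_.nonNeg
  ; ∥∥-mono = λ r≤s (0≤r & z≤) → ℚ.≤-trans 0≤r r≤s &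
      eventually-map (λ _ z≤ → ℚ.≤-trans z≤ (*-mono-≤ (ℚ.≤-trans 0≤r r≤s) 0≤r r≤s r≤s)) z≤
  ; ∥∥-resp = λ {_} {_} {r} (eventually z≐w) (0≤r & z≤) → 0≤r &
      eventually-zip (λ _ (p , q) → subst (ℚ._≤ r ℚ.* r) (cong₂ norm² p q)) z≐w z≤
  ; ∥0∥ = ℚ.≤-refl & always λ _ → ℚ.≤-refl
  ; ∥1∥ = 0≤1 & always λ _ → ℚ.≤-refl
  ; ∥+∥ = λ {z} {w} (0≤r & z≤) (0≤s & w≤) → +-nonNeg 0≤r 0≤s & eventually-zip
      (λ n → norm²-+ (seq (re z) n) (seq (im z) n) (seq (re w) n) (seq (im w) n) 0≤r 0≤s) z≤ w≤
  ; ∥*∥ = λ {z} {w} {r} {s} (0≤r & z≤) (0≤s & w≤) → nonNeg-* 0≤r 0≤s & eventually-zip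
      (λ n z≤ w≤ → subst₂ ℚ._≤_
        (sym (norm²-* (seq (re z) n) (seq (im z) n) (seq (re w) n) (seq (im w) n))) (swap r s)
        (*-mono-≤ (nonNeg-* 0≤r 0≤r) (norm²-nonNeg (seq (re w) n) (seq (im w) n)) z≤ w≤)) z≤ w≤
  ; ∥-∥ = λ {z} {r} (0≤r & z≤) → 0≤r & eventually-map
      (λ n → subst (ℚ._≤ r ℚ.* r) (norm²-neg (seq (re z) n) (seq (im z) n))) z≤
  ; bounded = norm-bounded
  ; ∥∥-cancel = λ {z} {w} → norm-cancel {z} {w}
  ; complete = ℂ-complete
  }
  where
  open ℚ-Solver
  swap : ∀ r s → r ℚ.* r ℚ.* (s ℚ.* s) ≡ r ℚ.* s ℚ.* (r ℚ.* s)
  swap = solve 2 (λ r s → r :* r :* (s :* s) := r :* s :* (r :* s)) refl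
  norm²-neg : ∀ x y → norm² x y ≡ norm² (ℚ.- x) (ℚ.- y)
  norm²-neg = solve 2 (λ x y → x :* x :+ y :* y := (:- x) :* (:- x) :+ (:- y) :* (:- y)) refl

-- Norm bounds compared with `_⟶_`, `_≈_` and `∣_∣`

private
  module V = NullSequences ℂ-normedRing
  module N = NormedRing ℂ-normedRing

-- The left end of a bisection bracket is 0 or has square at most p, so a bound δ² on the squared
-- distance bounds every approximation of the root by δ. The other half of ε₀ provides the gap that
-- `_<ᴿ_` demands.
⟶-null : ∀ {f l} → V.Null (λ n → f n - l) → f ⟶ l
⟶-null {f} {l} f→l ε (ε₀ , 0<ε₀ , ε₀≤ε) = eventually-map
  (λ n (_ & small) → δ , half-pos 0<ε₀ , eventually-zip
    (λ i small ε₀≤ε → begin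
      sqrtApprox i (seq ∣ f n - l ∣² i) ℚ.+ δ
        ≤⟨ ℚ.+-monoˡ-≤ δ (sqrt≤ i _ (ℚ.<⇒≤ (half-pos 0<ε₀)) small) ⟩
      δ ℚ.+ δ
        ≡⟨ trans (half+half ε₀) (sym (ℚ.+-identityˡ ε₀)) ⟩
      0ℚ ℚ.+ ε₀
        ≤⟨ ε₀≤ε ⟩
      seq ε i ∎)
    small ε₀≤ε)
  (f→l δ (half-pos 0<ε₀))
  where
  open ℚ.≤-Reasoning
  δ = ε₀ ℚ.* ½
  sqrt≤ : ∀ i p {δ} → 0ℚ ℚ.≤ δ → p ℚ.≤ δ ℚ.* δ → sqrtApprox i p ℚ.≤ δ
  sqrt≤ i p {δ} 0≤δ p≤δ² with Bracket.lower (bisect-bracket p i)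
  ... | inj₁ l≡0  = subst (ℚ._≤ δ) (sym l≡0) 0≤δ
  ... | inj₂ l²≤p = sqr-cancel-≤ 0≤δ (ℚ.≤-trans l²≤p p≤δ²)

≈-from-norm : ∀ {z w} → (∀ ε → 0ℚ ℚ.< ε → ∥ z - w ∥≤ ε) → z ≈ w
≈-from-norm {z} {w} z-w≤ =
  (λ ε 0<ε → eventually-map
    (λ n → below 0<ε (∣re∣≤ (seq (re (z - w)) n) (seq (im (z - w)) n) (ℚ.<⇒≤ (half-pos 0<ε))))
    (∥_∥≤_.bound (z-w≤ (ε ℚ.* ½) (half-pos 0<ε)))) ,
  (λ ε 0<ε → eventually-map
    (λ n → below 0<ε (∣im∣≤ (seq (re (z - w)) n) (seq (im (z - w)) n) (ℚ.<⇒≤ (half-pos 0<ε))))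
    (∥_∥≤_.bound (z-w≤ (ε ℚ.* ½) (half-pos 0<ε))))
  where
  below : ∀ {ε x} {A : Set} → 0ℚ ℚ.< ε → (A → x ℚ.≤ ε ℚ.* ½) → A → x ℚ.< ε
  below 0<ε x≤ a = ℚ.≤-<-trans (x≤ a) (half-< 0<ε)

-- The upper end h of the bisection bracket satisfies h ≤ √∣z∣² + ε/2 ≤ 1 − ε/2.
∣∣<1⇒norm : ∀ z → ∣ z ∣ <ᴿ 1ᴿ → ∃[ r ] r ℚ.< 1ℚ × ∥ z ∥≤ r
∣∣<1⇒norm z (ε , 0<ε , N , sqrt≤) = r , r<1 , 0≤r & norm≤
  where
  open ℚ.≤-Reasoning
  δ r : ℚ
  δ = ε ℚ.* ½
  r = 1ℚ ℚ.- δ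
  p = seq ∣ z ∣²

  r<1 : r ℚ.< 1ℚ
  r<1 = subst (r ℚ.<_) (ℚ.+-identityʳ 1ℚ) (ℚ.+-monoʳ-< 1ℚ (ℚ.neg-antimono-< (half-pos 0<ε)))

  0≤r : 0ℚ ℚ.≤ r
  -- Since the left end is nonnegative, the hypothesis at index N forces ε ≤ 1.
  0≤r = 0≤q-p (ℚ.≤-trans (ℚ.<⇒≤ (half-< 0<ε))
    (ℚ.≤-trans (≤-+ˡ ε (Bracket.0≤l (bisect-bracket (p N) N))) (sqrt≤ N ℕ.≤-refl)))

  bound = eventuallyBounded {p} (cauchy ∣ z ∣²)
  B = proj₁ bound

  upper-≤ : ∀ n → sqrtApprox n (p n) ℚ.+ ε ℚ.≤ 1ℚ → ℚ.∣ p n ∣ ℚ.≤ B → (1ℚ ℚ.+ B) ℚ.* ½^ n ℚ.< δ →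
            p n ℚ.≤ r ℚ.* r
  upper-≤ n l+ε≤1 p≤B small = ℚ.≤-trans upper (*-mono-≤ 0≤r 0≤h h≤r h≤r)
    where
    open Bracket (bisect-bracket (p n) n)
    l = proj₁ (bisect (p n) n)
    h = proj₂ (bisect (p n) n)
    0≤h : 0ℚ ℚ.≤ h
    0≤h = ℚ.≤-trans 0≤l l≤h
    regroup : ∀ h l e → h ≡ (h ℚ.- l) ℚ.+ (l ℚ.+ (e ℚ.* ½ ℚ.+ e ℚ.* ½)) ℚ.- e
    regroup = solve 3 (λ h l e → h := (h :- l) :+ (l :+ (e :* con ½ :+ e :* con ½)) :- e) refl
      where open ℚ-Solver
    collect : ∀ e → e ℚ.* ½ ℚ.+ 1ℚ ℚ.- e ≡ 1ℚ ℚ.- e ℚ.* ½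
    collect = solve 1 (λ e → e :* con ½ :+ con 1ℚ :- e := con 1ℚ :- e :* con ½) refl
      where open ℚ-Solver
    h-l≤δ : h ℚ.- l ℚ.≤ δ
    h-l≤δ = begin
      h ℚ.- l                               ≡⟨ width ⟩
      (1ℚ ℚ.+ ℚ.∣ p n ∣) ℚ.* ½^ n           ≤⟨ ℚ.*-monoʳ-≤-nonNeg (½^ n) {{ℚ.nonNegative (ℚ.<⇒≤ (½^-pos n))}}
                                                 (ℚ.+-monoʳ-≤ 1ℚ p≤B) ⟩
      (1ℚ ℚ.+ B) ℚ.* ½^ n                   <⟨ small ⟩
      δ                                     ∎
    h≤r : h ℚ.≤ r
    h≤r = begin
      h                                     ≡⟨ regroup h l ε ⟩
      (h ℚ.- l) ℚ.+ (l ℚ.+ (δ ℚ.+ δ)) ℚ.- ε ≡⟨ cong (λ e → (h ℚ.- l) ℚ.+ (l ℚ.+ e) ℚ.- ε) (half+half ε) ⟩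
      (h ℚ.- l) ℚ.+ (l ℚ.+ ε) ℚ.- ε         ≤⟨ ℚ.+-monoˡ-≤ (ℚ.- ε) (ℚ.+-mono-≤ h-l≤δ l+ε≤1) ⟩
      δ ℚ.+ 1ℚ ℚ.- ε                        ≡⟨ collect ε ⟩
      r                                     ∎

  norm≤ : Eventually (λ n → p n ℚ.≤ r ℚ.* r)
  norm≤ = eventually-zip (λ n (l+ε≤1 , p≤B) → upper-≤ n l+ε≤1 p≤B)
    (eventually-zip (λ _ → _,_) (N , sqrt≤) (proj₂ (proj₂ bound)))
    (½^-small (ℚ.+-mono-< 0<1 (proj₁ (proj₂ bound))) (half-pos 0<ε))

-- Apartness from 0 and division

#0-intro : ∀ {z ε} → 0ℚ ℚ.< ε → Eventually (λ n → ε ℚ.≤ seq ∣ z ∣² n) → z #0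
#0-intro {z} {ε} 0<ε ε≤ = ε , 0<ε ,
  eventually-map (λ n → subst (ℚ._≤ seq ∣ z ∣² n) (sym (ℚ.+-identityˡ ε))) ε≤

#0-elim : ∀ {z} → z #0 → ∃[ ε ] 0ℚ ℚ.< ε × Eventually (λ n → ε ℚ.≤ seq ∣ z ∣² n)
#0-elim {z} (ε , 0<ε , ε≤) = ε , 0<ε ,
  eventually-map (λ n → subst (ℚ._≤ seq ∣ z ∣² n) (ℚ.+-identityˡ ε)) ε≤

#0-resp : ∀ {z w} → z ≐ w → z #0 → w #0
#0-resp {z} {w} (eventually z≐w) z#0 with #0-elim {z} z#0
... | ε , 0<ε , ε≤ = #0-intro {w} 0<ε
  (eventually-zip (λ _ (p , q) → subst (ε ℚ.≤_) (cong₂ norm² p q)) z≐w ε≤)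

#0-1- : ∀ {z r} → ∥ z ∥≤ r → r ℚ.< 1ℚ → (1ℂ - z) #0
#0-1- {z} {r} (0≤r & z≤) r<1 = #0-intro {1ℂ - z} (*-pos (0<q-p r<1) (0<q-p r<1))
  (eventually-map (λ n → norm²-1- (seq (re z) n) (seq (im z) n) 0≤r r<1) z≤)

#0-* : ∀ {z w} → z #0 → w #0 → (z * w) #0
#0-* {z} {w} z#0 w#0 with #0-elim {z} z#0 | #0-elim {w} w#0
... | ε , 0<ε , ε≤ | δ , 0<δ , δ≤ = #0-intro {z * w} (*-pos 0<ε 0<δ) (eventually-zip
  (λ n ε≤ δ≤ → subst (ε ℚ.* δ ℚ.≤_)
    (sym (norm²-* (seq (re z) n) (seq (im z) n) (seq (re w) n) (seq (im w) n)))
    (*-mono-≤ (norm²-nonNeg (seq (re z) n) (seq (im z) n)) (ℚ.<⇒≤ 0<δ) ε≤ δ≤))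
  ε≤ δ≤)

-- A bound |w| ≤ B turns |z|²|w|² ≥ ε into |z|² ≥ ε/(1 + B²), where the 1 keeps the denominator
-- positive.
#0-factorˡ : ∀ z w → (z * w) #0 → z #0
#0-factorˡ z w zw#0 with #0-elim {z * w} zw#0 | norm-bounded w
... | ε , 0<ε , ε≤ | B , 0≤B & w≤B = #0-intro {z} (*-pos 0<ε (inv-pos 0<K)) (eventually-zip
  (λ n ε≤ w≤B → let x = seq (re z) n ; y = seq (im z) n ; c = seq (re w) n ; d = seq (im w) n in
    ℚ.*-cancelˡ-≤-pos K {{ℚ.positive 0<K}} (begin
      K ℚ.* (ε ℚ.* inv K)      ≡⟨ *-cancel-inv ε 0<K ⟩
      ε                        ≤⟨ ε≤ ⟩
      seq ∣ z * w ∣² n         ≡⟨ norm²-* x y c d ⟩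
      norm² x y ℚ.* norm² c d  ≤⟨ *-monoʳ-≤ (norm² x y) (norm²-nonNeg x y) (ℚ.≤-trans w≤B (≤-+ˡ (B ℚ.* B) 0≤1)) ⟩
      norm² x y ℚ.* K          ≡⟨ ℚ.*-comm (norm² x y) K ⟩
      K ℚ.* norm² x y          ∎))
  ε≤ w≤B)
  where
  open ℚ.≤-Reasoning
  K = 1ℚ ℚ.+ B ℚ.* B
  0<K : 0ℚ ℚ.< K
  0<K = ℚ.<-≤-trans 0<1 (≤-+ʳ 1ℚ (nonNeg-* 0≤B 0≤B))

-- Equality of terms is guaranteed from the index N on, where |w|² is bounded below; an earlier term
-- may be 0, and `inv` then returns its default 0. Hence `_≐_` compares terms only eventually.
*-inverseʳ : ∀ w (w#0 : w #0) → w * (1ℂ / w ⟨ w#0 ⟩) ≐ 1ℂ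
*-inverseʳ w w#0@(_ , 0<ε , N , ε≤) = eventually (N , λ n N≤n →
  let a = seq (re w) n ; b = seq (im w) n
      i≡ = inv-* {norm² a b} (ℚ.<-≤-trans (subst (0ℚ ℚ.<_) (sym (ℚ.+-identityˡ _)) 0<ε) (ε≤ n N≤n))
  in trans (real a b (inv (norm² a b))) i≡ , imaginary a b (inv (norm² a b)))
  where
  open ℚ-Solver
  real : ∀ a b i → a ℚ.* (1ℚ ℚ.* (a ℚ.* i) ℚ.+ ℚ.- (0ℚ ℚ.* (ℚ.- b ℚ.* i)))
    ℚ.+ ℚ.- (b ℚ.* (1ℚ ℚ.* (ℚ.- b ℚ.* i) ℚ.+ 0ℚ ℚ.* (a ℚ.* i))) ≡ norm² a b ℚ.* i
  real = solve 3 (λ a b i → a :* (con 1ℚ :* (a :* i) :+ :- (con 0ℚ :* (:- b :* i)))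
    :+ :- (b :* (con 1ℚ :* (:- b :* i) :+ con 0ℚ :* (a :* i))) := (a :* a :+ b :* b) :* i) refl
  imaginary : ∀ a b i → a ℚ.* (1ℚ ℚ.* (ℚ.- b ℚ.* i) ℚ.+ 0ℚ ℚ.* (a ℚ.* i))
    ℚ.+ b ℚ.* (1ℚ ℚ.* (a ℚ.* i) ℚ.+ ℚ.- (0ℚ ℚ.* (ℚ.- b ℚ.* i))) ≡ 0ℚ
  imaginary = solve 3 (λ a b i → a :* (con 1ℚ :* (:- b :* i) :+ con 0ℚ :* (a :* i))
    :+ b :* (con 1ℚ :* (a :* i) :+ :- (con 0ℚ :* (:- b :* i))) := con 0ℚ) refl

/-as-* : ∀ z w (w#0 : w #0) → z / w ⟨ w#0 ⟩ ≐ z * (1ℂ / w ⟨ w#0 ⟩)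
/-as-* z w w#0 = V.*-congˡ {z} (V.≈-sym (V.*-identityˡ (mkℂ (re w *ᴿ r) (-ᴿ im w *ᴿ r))))
  where r = recip ∣ w ∣² w#0

-- Application to the complex numbers

^-≡ : ∀ z n → z V.^ n ≡ z ^ n
^-≡ z zero    = refl
^-≡ z (suc n) = cong (z *_) (^-≡ z n)

∑-≡ : ∀ f n → V.∑ n f ≡ ∑< n f
∑-≡ f zero    = refl
∑-≡ f (suc n) = cong (_+ f n) (∑-≡ f n)

upper-bound-below : ∀ {p q t} → p ℚ.< t → q ℚ.< t → ∃[ m ] m ℚ.< t × p ℚ.≤ m × q ℚ.≤ m
upper-bound-below {p} {q} p<t q<t with ℚ.≤-total p q
... | inj₁ p≤q = q , q<t , p≤q , ℚ.≤-refl
... | inj₂ q≤p = p , p<t , ℚ.≤-refl , q≤p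

common-radius : ∀ z w → ∣ z ∣ <ᴿ 1ᴿ → ∣ w ∣ <ᴿ 1ᴿ →
                ∃[ r ] 0ℚ ℚ.< r × r ℚ.< 1ℚ × ∥ z ∥≤ r × ∥ w ∥≤ r
common-radius z w ∣z∣<1 ∣w∣<1 =
  let r , r<1 , z≤r = ∣∣<1⇒norm z ∣z∣<1
      s , s<1 , w≤s = ∣∣<1⇒norm w ∣w∣<1
      t , t<1 , r≤t , s≤t = upper-bound-below r<1 s<1
      -- Including ½ makes the radius positive even when z = q = 0.
      m , m<1 , ½≤m , t≤m = upper-bound-below {½} (half-< 0<1) t<1
  in m , ℚ.<-≤-trans (ℚ.positive⁻¹ ½) ½≤m , m<1 ,
     N.∥∥-mono {z} (ℚ.≤-trans r≤t t≤m) z≤r , N.∥∥-mono {w} (ℚ.≤-trans s≤t t≤m) w≤s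

poch-#0 : ∀ {q r} → r ℚ.< 1ℚ → ∥ q ∥≤ r → ∀ n → poch q q n #0
-- The empty product 1 is treated as 1 - 0, so that `#0-1-` covers it as well.
poch-#0 r<1 q≤r zero    = #0-resp {1ℂ - (1ℂ - 1ℂ)} {1ℂ} (V.1-[1-x]≈x 1ℂ)
  (#0-1- {1ℂ - 1ℂ} (N.∥∥-resp (V.≈-sym (V.-‿inverseʳ 1ℂ)) N.∥0∥) 0<1)
poch-#0 {q} {r} r<1 q≤r (suc n) = #0-* {poch q q n} {pochFactor q q n} (poch-#0 r<1 q≤r n)
  (#0-1- {q * q ^ n} (subst (λ p → ∥ q * p ∥≤ (r ℚ.* r ^ℚ n)) (^-≡ q n) (V.∥^∥ q≤r (suc n)))
    (ℚ.≤-<-trans (^-suc-≤ (∥_∥≤_.nonNeg q≤r) (ℚ.<⇒≤ r<1) n) r<1))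

module Convergence {z q : ℂ} {r : ℚ} (0<r : 0ℚ ℚ.< r) (r<1 : r ℚ.< 1ℚ)
  (z≤r : ∥ z ∥≤ r) (q≤r : ∥ q ∥≤ r) (q#0 : ∀ n → poch q q n #0) where

  open QSeries.Base ℂ-normedRing {q} {r} 0<r r<1 q≤r

  poch-isPoch : ∀ x → IsPoch x (poch x q)
  poch-isPoch x = record
    { base = V.≈-refl {1ℂ}
    ; step = λ n → V.≈-reflexive (cong (λ p → poch x q n * (1ℂ - x * p)) (sym (^-≡ q n)))
    }

  term : ℂ → ℕ → ℂ
  term a n = (poch a q n * z ^ n) / poch q q n ⟨ q#0 n ⟩

  term-isTerms : ∀ a → IsTerms a z (term a)
  term-isTerms a = quotient-terms {a} {z} {poch a q} {poch q q} {term a} {λ n → 1ℂ / poch q q n ⟨ q#0 n ⟩}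
    (poch-isPoch a) (poch-isPoch q)
    (λ n → *-inverseʳ (poch q q n) (q#0 n))
    (λ n → V.≈-trans (/-as-* (poch a q n * z ^ n) (poch q q n) (q#0 n))
      (V.≈-reflexive (cong (λ p → poch a q n * p * (1ℂ / poch q q n ⟨ q#0 n ⟩)) (sym (^-≡ z n)))))

  module L = Limits {z} z≤r {λ x → poch x q} poch-isPoch {term} term-isTerms
  open L public using (s; u; v)

  hasSum : ∀ a → HasSum (term a) (s a)
  hasSum a = ⟶-null {λ n → ∑< n (term a)} {s a}
    (V.null-resp {λ n → V.∑ n (term a) - s a} {λ n → ∑< n (term a) - s a}
      (λ n → V.≈-reflexive (cong (_- s a) (∑-≡ (term a) n))) (proj₂ (L.sum a)))

  isPoch∞ : ∀ x → IsPoch∞ x q (u x)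
  isPoch∞ x = ⟶-null {poch x q} {u x} (proj₂ (L.poch∞ x))

  -- Closeness suffices in place of an exact inverse: v · `s 0ℂ` lies within ½ of 1, hence is apart
  -- from 0, and so is its factor v.
  v#0 : v #0
  v#0 = #0-factorˡ v (s 0ℂ) (#0-resp {1ℂ - (1ℂ - v * s 0ℂ)} {v * s 0ℂ} (V.1-[1-x]≈x (v * s 0ℂ))
    (#0-1- {1ℂ - v * s 0ℂ} (L.v-invertible ½ (ℚ.positive⁻¹ ½)) (half-< 0<1)))

  s≈u/v : ∀ a → s a ≈ u (a * z) / v ⟨ v#0 ⟩
  s≈u/v a = ≈-from-norm {s a} {u (a * z) / v ⟨ v#0 ⟩}
    (L.sum-quotient a {1ℂ / v ⟨ v#0 ⟩} {u (a * z) / v ⟨ v#0 ⟩}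
      (*-inverseʳ v v#0) (/-as-* (u (a * z)) v v#0))

theorem1 : ∀ (a z q : ℂ) → ∣ z ∣ <ᴿ 1ᴿ → ∣ q ∣ <ᴿ 1ᴿ →
    Σ[ q#0 ∈ (∀ n → poch q q n #0) ]
    ∃[ s ] ∃[ u ] ∃[ v ] Σ[ v#0 ∈ v #0 ]
    HasSum (λ n → (poch a q n * z ^ n) / poch q q n ⟨ q#0 n ⟩) s ×
    IsPoch∞ (a * z) q u ×
    IsPoch∞ z q v ×
    s ≈ u / v ⟨ v#0 ⟩
theorem1 a z q ∣z∣<1 ∣q∣<1 =
  q#0 , s a , u (a * z) , v , v#0 , hasSum a , isPoch∞ (a * z) , isPoch∞ z , s≈u/v a
  where
  radius : ∃[ r ] 0ℚ ℚ.< r × r ℚ.< 1ℚ × ∥ z ∥≤ r × ∥ q ∥≤ r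
  radius = common-radius z q ∣z∣<1 ∣q∣<1
  r = proj₁ radius
  0<r = proj₁ (proj₂ radius)
  r<1 = proj₁ (proj₂ (proj₂ radius))
  z≤r = proj₁ (proj₂ (proj₂ (proj₂ radius)))
  q≤r = proj₂ (proj₂ (proj₂ (proj₂ radius)))

  q#0 : ∀ n → poch q q n #0
  q#0 = poch-#0 {q} {r} r<1 q≤r

  open Convergence {z} {q} {r} 0<r r<1 z≤r q≤r q#0
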